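{- For every $n\geq 1$, the sequence $I_{n,0},I_{n,1},\ldots,I_{n,n-1}$ is unimodal, i.e., there is an index $j$ with $I_{n,0}\leq\cdots\leq I_{n,j}\geq I_{n,j+1}\geq\cdots\geq I_{n,n-1}$.
   Context: For a permutation $\pi=a_1a_2\cdots a_m$ of $[m]=\{1,\ldots,m\}$, a descent is an index $1\leq i\leq m-1$ with $a_i>a_{i+1}$. An involution of $[m]$ is a permutation $\pi$ with $\pi^2=\mathrm{id}$. $I_{m,j}$ denotes the number of involutions of $[m]$ with exactly $j$ descents. -}

module Defs where

open import Data.Fin using (Fin; suc; inject₁; _>_)
open import Data.Fin.Properties using (all?; _≟_; _<?_)
open import Data.List using (List; []; _∷_; length; filter; allFin; cartesianProductWith)
open import Data.Nat as ℕ using (ℕ; zero; suc)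
open import Data.Product using (_×_; ∃-syntax)
open import Data.Vec as Vec using (Vec; lookup)
open import Function.Definitions using (Injective)
open import Relation.Binary.PropositionalEquality using (_≡_)
open import Relation.Nullary.Decidable using (_×-dec_; _→-dec_; map′)
open import Relation.Unary using (Decidable)

-- A permutation of [m] is written in one-line notation a₁ a₂ ⋯ aₘ, with the
-- letters and the positions both shifted down to Fin m = {0, …, m-1}.

Word : ℕ → Set
Word m = Vec (Fin m) m

-- An injective self-map of a finite set is bijective.
IsPermutation : ∀ {m} → Word m → Set
IsPermutation π = Injective _≡_ _≡_ (lookup π)

IsInvolution : ∀ {m} → Word m → Set
IsInvolution π = IsPermutation π × (∀ i → lookup π (lookup π i) ≡ i)

IsDescent : ∀ {k} → Word (suc k) → Fin k → Set
IsDescent π i = lookup π (inject₁ i) > lookup π (suc i)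

isDescent? : ∀ {k} (π : Word (suc k)) → Decidable (IsDescent π)
isDescent? π i = lookup π (suc i) <? lookup π (inject₁ i)

descents : ∀ {m} → Word m → ℕ
descents {zero}  π = 0
descents {suc k} π = length (filter (isDescent? π) (allFin k))

isPermutation? : ∀ {m} → Decidable (IsPermutation {m})
isPermutation? π =
  map′ (λ inj {i} {j} → inj i j) (λ inj i j → inj {i} {j})
    (all? λ i → all? λ j → (lookup π i ≟ lookup π j) →-dec (i ≟ j))

isInvolution? : ∀ {m} → Decidable (IsInvolution {m})
isInvolution? π =
  isPermutation? π ×-dec all? (λ i → lookup π (lookup π i) ≟ i)

-- Each vector over Fin m of length k occurs exactly once, so the length of a
-- filtered sublist is a cardinality.
allVecs : ∀ m k → List (Vec (Fin m) k)
allVecs m zero    = Vec.[] ∷ []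
allVecs m (suc k) = cartesianProductWith Vec._∷_ (allFin m) (allVecs m k)

I : ℕ → ℕ → ℕ
I m j = length (filter (λ π → isInvolution? π ×-dec (descents π ℕ.≟ j)) (allVecs m m))

-- Unimodality of the finite sequence a 0, …, a (n-1); values of a at
-- arguments ≥ n play no role.
Unimodal : ℕ → (ℕ → ℕ) → Set
Unimodal n a =
  ∃[ j ] j ℕ.< n
       × (∀ i → i ℕ.< j → a i ℕ.≤ a (suc i))
       × (∀ i → j ℕ.≤ i → suc i ℕ.< n → a (suc i) ℕ.≤ a i)

{-# OPTIONS --safe #-}

-- Call a word w compatible with an involution π of [n] if it is weakly increasing, and strictly so at the
-- descents of π.  There are Σⱼ I n j · C(n+r-j, n) pairs (π, w) with w compatible with π and letters in
-- {0, …, r}: the sum is the (n+1)-fold iterated partial sum of the row I n.  The multiset of pairs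
-- (wᵢ, w_π(i)) is a symmetric (r+1) × (r+1) matrix with entry sum n, and determines (π, w), as one sees
-- by removing, one after the other, the cycles of π through position 0.  So the pairs have the generating
-- function (1 - u)^(-(r+1)) (1 - u²)^(-r(r+1)/2), whose logarithmic derivative yields a recurrence in n with
-- coefficients polynomial in r.  Undoing the partial sums turns it into the recurrence of Guo and Zeng for the
-- rows I n, from which symmetry and then unimodality follow by induction on n.

module Submission where

open import Defs
open import Data.Bool using (true; false; if_then_else_)
open import Data.Empty using (⊥; ⊥-elim)
open import Data.Fin as Fin using (Fin; zero; suc; toℕ; inject₁; punchIn; punchOut)
import Data.Fin.Properties as Fin
open import Data.Integer as ℤ using (ℤ; drop‿+≤+)
import Data.Integer.Properties as ℤ
open import Data.List as List using (List; []; _∷_; length; filter; map; tabulate; allFin; _++_)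
import Data.List.Properties as List
open import Data.List.Membership.Propositional using (_∈_)
open import Data.List.Membership.Propositional.Properties
open import Data.List.Membership.Propositional.Properties.WithK using (unique∧set⇒bag)
open import Data.List.Relation.Binary.BagAndSetEquality using (∼bag⇒↭)
open import Data.List.Relation.Binary.Permutation.Propositional.Properties using (↭-length)
import Data.List.Relation.Unary.All as All
import Data.List.Relation.Unary.AllPairs as AllPairs
open import Data.List.Relation.Unary.Any using (here; there)
open import Data.List.Relation.Unary.Unique.Propositional using (Unique)
import Data.List.Relation.Unary.Unique.Propositional.Properties as Unique
open import Data.Nat as ℕ using (ℕ; zero; suc; z≤n; s≤s; ⌊_/2⌋; ⌈_/2⌉)
open import Data.Nat.GeneralisedArithmetic using (fold)
open import Data.Nat.ListAction using (sum)
import Data.Nat.Properties as ℕ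
open import Data.Product using (_×_; _,_; ∃-syntax; proj₁; proj₂)
open import Data.Sum using (_⊎_; inj₁; inj₂; [_,_]′)
open import Data.Unit using (⊤; tt)
open import Data.Vec as Vec using (Vec; []; _∷_; lookup; insertAt; removeAt)
import Data.Vec.Properties as Vec
open import Function using (_∘_; id)
open import Function.Bundles using (mk⇔)
open import Relation.Binary.PropositionalEquality
open import Relation.Nullary using (¬_; does; proof; ofʸ; ofⁿ; yes; no)
open import Relation.Nullary.Decidable using (_×-dec_)
open import Relation.Unary using (Decidable)


-- The matrix is never built. Its entries (a, j) with a ≤ j are released one at a time: a unit on
-- the diagonal is a fixed point and gives a factor 1/(1 - u), a unit off the diagonal, together
-- with its mirror image, is a two-cycle and gives a factor 1/(1 - u²). Symmetry of the rows is not
-- visible on words: reversing an involution exchanges ascents and descents but need not yield an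
-- involution. It is read off from the recurrence instead. For unimodality the recurrence is applied
-- to differences of neighbouring entries, where all coefficients are nonnegative. The obstacle is a
-- row of odd length 2k+1: one of the differences used lies just past the centre and is nonpositive.
-- By symmetry it is the opposite of its neighbour, whose coefficient absorbs it except for k = 1;
-- this is why the row of [3] is treated by a direct computation.

module Counting where

  open import Data.Nat using (_+_; _*_; _≤_; _<_)
  open import Data.Nat.Tactic.RingSolver using (solve-∀)
  open ≡-Reasoning

  private variable
    A B : Set
    P Q : A → Set
    m n : ℕ

  -- Partial sums and the recurrence for symmetric matrices

  partialSum : (ℕ → ℕ) → ℕ → ℕ
  partialSum f zero    = f zero
  partialSum f (suc n) = f (suc n) + partialSum f n

  partialSum₂ : (ℕ → ℕ) → ℕ → ℕ
  partialSum₂ f zero          = f zero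
  partialSum₂ f (suc zero)    = f (suc zero)
  partialSum₂ f (suc (suc n)) = f (suc (suc n)) + partialSum₂ f n

  iterate : (A → A) → ℕ → A → A
  iterate g n x = fold x g n

  δ : ℕ → ℕ
  δ zero    = 1
  δ (suc _) = 0

  -- symmetricMatrices d n is the coefficient of uⁿ in (1 - u)^(-d) (1 - u²)^(-d(d-1)/2), the number of
  -- symmetric d × d matrices over ℕ with entry sum n.
  symmetricMatrices : ℕ → ℕ → ℕ
  symmetricMatrices zero    = δ
  symmetricMatrices (suc d) = partialSum (iterate partialSum₂ d (symmetricMatrices d))

  -- For F = Σ f n uⁿ this is the differential equation (1 - u²) F' = (a + c u) F, read
  -- coefficientwise. Multiplying F by 1/(1 - u) adds (1 + u)/(1 - u²) to F'/F, and multiplying by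
  -- 1/(1 - u²) adds 2u/(1 - u²), which explains how the parameters change below.
  record Recurrent (a c : ℕ) (f : ℕ → ℕ) : Set where
    constructor recurrent
    field
      initial : f 1 ≡ a * f 0
      step    : ∀ n → (2 + n) * f (2 + n) ≡ a * f (1 + n) + (c + n) * f n

  δ-recurrent : Recurrent 0 0 δ
  δ-recurrent = recurrent refl λ { zero → refl ; (suc n) → trans (ℕ.*-zeroʳ (3 + n)) (sym (ℕ.*-zeroʳ n)) }

  partialSum-recurrent : ∀ {a c f} → Recurrent a c f → Recurrent (1 + a) (1 + c) (partialSum f)
  partialSum-recurrent {a} {c} {f} (recurrent f₁ rec) =
    recurrent (trans (cong (_+ f 0) f₁) (ℕ.+-comm (a * f 0) (f 0))) go
    where
    g = partialSum f
    -- `h` stands for `g (n - 1)`, taken as 0 when n = 0, so that one computation serves the base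
    -- case and the induction.
    step : ∀ n h → (1 + n) * g (1 + n) ≡ (1 + a) * g n + (c + n) * h → f n + h ≡ g n →
           (2 + n) * g (2 + n) ≡ (1 + a) * g (1 + n) + (1 + c + n) * g n
    step n h ih eq = begin
      (2 + n) * (f (2 + n) + g (1 + n))
        ≡⟨ solve₁ n (f (2 + n)) (g (1 + n)) ⟩
      (2 + n) * f (2 + n) + (1 + n) * g (1 + n) + g (1 + n)
        ≡⟨ cong₂ (λ x y → x + y + g (1 + n)) (rec n) ih ⟩
      a * f (1 + n) + (c + n) * f n + ((1 + a) * g n + (c + n) * h) + g (1 + n)
        ≡⟨ solve₂ a (c + n) (f (1 + n)) (f n) (g n) h ⟩
      (1 + a) * g (1 + n) + ((c + n) * (f n + h) + g n)
        ≡⟨ cong (λ x → (1 + a) * g (1 + n) + ((c + n) * x + g n)) eq ⟩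
      (1 + a) * g (1 + n) + ((c + n) * g n + g n)
        ≡⟨ cong ((1 + a) * g (1 + n) +_) (ℕ.+-comm ((c + n) * g n) (g n)) ⟩
      (1 + a) * g (1 + n) + (1 + c + n) * g n ∎
      where
      solve₁ : ∀ n x y → (2 + n) * (x + y) ≡ (2 + n) * x + (1 + n) * y + y
      solve₁ = solve-∀
      solve₂ : ∀ a d x y z h → a * x + d * y + ((1 + a) * z + d * h) + (x + z)
                             ≡ (1 + a) * (x + z) + (d * (y + h) + z)
      solve₂ = solve-∀
    go : ∀ n → (2 + n) * g (2 + n) ≡ (1 + a) * g (1 + n) + (1 + c + n) * g n
    go zero = step 0 0 (begin
      1 * (f 1 + f 0)           ≡⟨ cong (λ x → 1 * (x + f 0)) f₁ ⟩
      1 * (a * f 0 + f 0)       ≡⟨ solve₃ a c (f 0) ⟩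
      (1 + a) * f 0 + (c + 0) * 0 ∎) (ℕ.+-identityʳ (f 0))
      where
      solve₃ : ∀ a c x → 1 * (a * x + x) ≡ (1 + a) * x + (c + 0) * 0
      solve₃ = solve-∀
    go (suc n) = step (suc n) (g n)
      (trans (go n) (cong (λ x → (1 + a) * g (1 + n) + x * g n) (sym (ℕ.+-suc c n)))) refl

  partialSum₂-recurrent : ∀ {a c f} → Recurrent a c f → Recurrent a (2 + c) (partialSum₂ f)
  partialSum₂-recurrent {a} {c} {f} (recurrent f₁ rec) = recurrent f₁ go
    where
    g = partialSum₂ f
    -- `h₁` and `h₂` stand for `g (n - 1)` and `g (n - 2)`, with value 0 at negative arguments.
    step : ∀ n h₁ h₂ → n * g n ≡ a * h₁ + (c + n) * h₂ → f (1 + n) + h₁ ≡ g (1 + n) → f n + h₂ ≡ g n →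
           (2 + n) * g (2 + n) ≡ a * g (1 + n) + (2 + c + n) * g n
    step n h₁ h₂ ih eq₁ eq₂ = begin
      (2 + n) * (f (2 + n) + g n)
        ≡⟨ solve₁ n (f (2 + n)) (g n) ⟩
      (2 + n) * f (2 + n) + n * g n + 2 * g n
        ≡⟨ cong₂ (λ x y → x + y + 2 * g n) (rec n) ih ⟩
      a * f (1 + n) + (c + n) * f n + (a * h₁ + (c + n) * h₂) + 2 * g n
        ≡⟨ solve₂ a (c + n) (f (1 + n)) (f n) h₁ h₂ (g n) ⟩
      a * (f (1 + n) + h₁) + ((c + n) * (f n + h₂) + 2 * g n)
        ≡⟨ cong₂ (λ x y → a * x + ((c + n) * y + 2 * g n)) eq₁ eq₂ ⟩
      a * g (1 + n) + ((c + n) * g n + 2 * g n)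
        ≡⟨ solve₃ a c n (g (1 + n)) (g n) ⟩
      a * g (1 + n) + (2 + c + n) * g n ∎
      where
      solve₁ : ∀ n x y → (2 + n) * (x + y) ≡ (2 + n) * x + n * y + 2 * y
      solve₁ = solve-∀
      solve₂ : ∀ a d x y h₁ h₂ z → a * x + d * y + (a * h₁ + d * h₂) + 2 * z
                                 ≡ a * (x + h₁) + (d * (y + h₂) + 2 * z)
      solve₂ = solve-∀
      solve₃ : ∀ a c n x y → a * x + ((c + n) * y + 2 * y) ≡ a * x + (2 + c + n) * y
      solve₃ = solve-∀
    go : ∀ n → (2 + n) * g (2 + n) ≡ a * g (1 + n) + (2 + c + n) * g n
    go zero = step 0 0 0 (solve₀ a c) (ℕ.+-identityʳ (f 1)) (ℕ.+-identityʳ (f 0))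
      where
      solve₀ : ∀ a c → 0 ≡ a * 0 + (c + 0) * 0
      solve₀ = solve-∀
    go (suc zero) = step 1 (g 0) 0 (trans (ℕ.+-identityʳ (f 1)) (trans f₁ (solve₁ a c (f 0)))) refl (ℕ.+-identityʳ (f 1))
      where
      solve₁ : ∀ a c x → a * x ≡ a * x + (c + 1) * 0
      solve₁ = solve-∀
    go (suc (suc n)) = step (2 + n) (g (1 + n)) (g n)
      (trans (go n) (cong (λ x → a * g (1 + n) + x * g n)
        (trans (cong suc (sym (ℕ.+-suc c n))) (sym (ℕ.+-suc c (suc n)))))) refl refl

  iterate-partialSum₂-recurrent : ∀ {a c f} d → Recurrent a c f → Recurrent a (2 * d + c) (iterate partialSum₂ d f)
  iterate-partialSum₂-recurrent zero r = r
  iterate-partialSum₂-recurrent {a} {c} {f} (suc d) r =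
    subst (λ x → Recurrent a x (iterate partialSum₂ (suc d) f)) (solve₁ d c)
      (partialSum₂-recurrent (iterate-partialSum₂-recurrent d r))
    where
    solve₁ : ∀ d c → 2 + (2 * d + c) ≡ 2 * (1 + d) + c
    solve₁ = solve-∀

  -- The d diagonal entries contribute d(1 + u) and the d(d-1)/2 entries above the diagonal
  -- contribute d(d-1)u to the numerator over 1 - u²; together this is d + d²u.
  symmetricMatrices-recurrent : ∀ d → Recurrent d (d * d) (symmetricMatrices d)
  symmetricMatrices-recurrent zero    = δ-recurrent
  symmetricMatrices-recurrent (suc d) =
    subst (λ x → Recurrent (suc d) x (symmetricMatrices (suc d))) (solve₁ d)
      (partialSum-recurrent (iterate-partialSum₂-recurrent d (symmetricMatrices-recurrent d)))
    where
    solve₁ : ∀ d → 1 + (2 * d + d * d) ≡ (1 + d) * (1 + d)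
    solve₁ = solve-∀

  -- Cardinalities of predicates

  -- The list holds elements and not proofs of `P`, so `P x` may have many proofs, as it does when
  -- it contains functions.
  record HasCard {A : Set} (P : A → Set) (n : ℕ) : Set where
    field
      elements : List A
      unique   : Unique elements
      sound    : ∀ {x} → x ∈ elements → P x
      complete : ∀ {x} → P x → x ∈ elements
      size     : length elements ≡ n

  open HasCard


  HasCard-unique : HasCard P m → HasCard P n → m ≡ n
  HasCard-unique c d = trans (sym (size c)) (trans (↭-length (∼bag⇒↭ (unique∧set⇒bag (unique c) (unique d)
    (mk⇔ (λ x∈ → complete d (sound c x∈)) (λ x∈ → complete c (sound d x∈)))))) (size d))

  HasCard-empty : (∀ {x} → ¬ P x) → HasCard P 0
  HasCard-empty ¬P = record
    { elements = [] ; unique = AllPairs.[] ; sound = λ () ; complete = λ p → ⊥-elim (¬P p) ; size = refl }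

  HasCard-singleton : ∀ {a : A} → P a → (∀ {x} → P x → x ≡ a) → HasCard P 1
  HasCard-singleton {a = a} Pa only = record
    { elements = a ∷ [] ; unique = All.[] AllPairs.∷ AllPairs.[] ; sound = λ { (here refl) → Pa }
    ; complete = λ p → here (only p) ; size = refl }

  HasCard-cong : (∀ {x} → P x → Q x) → (∀ {x} → Q x → P x) → HasCard P n → HasCard Q n
  HasCard-cong P⇒Q Q⇒P c = record
    { elements = elements c ; unique = unique c ; sound = λ x∈ → P⇒Q (sound c x∈)
    ; complete = λ q → complete c (Q⇒P q) ; size = size c }

  HasCard-⊎ : {P Q R : A → Set} →
              (∀ {x} → P x → Q x ⊎ R x) → (∀ {x} → Q x → P x) → (∀ {x} → R x → P x) →
              (∀ {x} → Q x → ¬ R x) → HasCard Q m → HasCard R n → HasCard P (m + n)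
  HasCard-⊎ split Q⇒P R⇒P disj c d = record
    { elements = elements c ++ elements d
    ; unique   = Unique.++⁺ (unique c) (unique d) λ (x∈c , x∈d) → disj (sound c x∈c) (sound d x∈d)
    ; sound    = λ x∈ → [ (λ x∈c → Q⇒P (sound c x∈c)) , (λ x∈d → R⇒P (sound d x∈d)) ]′ (∈-++⁻ (elements c) x∈)
    ; complete = λ p → [ (λ q → ∈-++⁺ˡ (complete c q)) , (λ r → ∈-++⁺ʳ (elements c) (complete d r)) ]′ (split p)
    ; size     = trans (List.length-++ (elements c)) (cong₂ _+_ (size c) (size d)) }

  Unique-map : ∀ {f : A → B} {xs} → (∀ {x y} → x ∈ xs → y ∈ xs → f x ≡ f y → x ≡ y) →
               Unique xs → Unique (map f xs)
  Unique-map {xs = []}     inj AllPairs.[]         = AllPairs.[]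
  Unique-map {f = f} {xs = x ∷ xs} inj (x∉ AllPairs.∷ uniq) =
    All.tabulate (λ fy∈ fx≡fy → let (y , y∈ , eq) = ∈-map⁻ f fy∈ in
      All.lookup x∉ y∈ (inj (here refl) (there y∈) (trans fx≡fy eq)))
    AllPairs.∷ Unique-map (λ p q → inj (there p) (there q)) uniq

  HasCard-map : ∀ (f : A → B) → (∀ {x} → P x → Q (f x)) → (∀ {x y} → P x → P y → f x ≡ f y → x ≡ y) →
                (∀ {y} → Q y → ∃[ x ] P x × f x ≡ y) → HasCard P n → HasCard Q n
  HasCard-map {Q = Q} f P⇒Q inj surj c = record
    { elements = map f (elements c)
    ; unique   = Unique-map (λ x∈ y∈ → inj (sound c x∈) (sound c y∈)) (unique c)
    ; sound    = λ y∈ → let (x , x∈ , eq) = ∈-map⁻ f y∈ in subst Q (sym eq) (P⇒Q (sound c x∈))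
    ; complete = λ q → let (x , p , eq) = surj q in subst (_∈ map f (elements c)) eq (∈-map⁺ f (complete c p))
    ; size     = trans (List.length-map f (elements c)) (size c) }

  HasCard-Σ : ∀ {Q : A → B → Set} (f : A → ℕ) {xs : List A} → Unique xs →
              (∀ {a} → a ∈ xs → HasCard (Q a) (f a)) →
              HasCard (λ ((a , b) : A × B) → a ∈ xs × Q a b) (sum (map f xs))
  HasCard-Σ         f {[]}     AllPairs.[]            fibre = HasCard-empty λ ()
  HasCard-Σ {Q = Q} f {a ∷ xs} (a∉ AllPairs.∷ uniq) fibre = HasCard-⊎
    {Q = λ (x , b) → x ≡ a × Q x b}
    {R = λ (x , b) → x ∈ xs × Q x b}
    (λ { (here refl , q) → inj₁ (refl , q) ; (there x∈ , q) → inj₂ (x∈ , q) })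
    (λ { (refl , q) → here refl , q })
    (λ (x∈ , q) → there x∈ , q)
    (λ { (refl , _) (x∈ , _) → All.lookup a∉ x∈ refl })
    (HasCard-map (a ,_) (refl ,_) (λ { _ _ refl → refl }) (λ { {_ , b} (refl , q) → b , q , refl })
      (fibre (here refl)))
    (HasCard-Σ f uniq (λ x∈ → fibre (there x∈)))

  -- Words compatible with a fixed permutation

  shift : (ℕ → ℕ) → ℕ → ℕ
  shift f zero    = 0
  shift f (suc n) = f n

  point : ℕ → ℕ → ℕ
  point k = iterate shift k δ

  partialSum-cong : ∀ {f g} → f ≗ g → partialSum f ≗ partialSum g
  partialSum-cong f≗g zero    = f≗g zero
  partialSum-cong f≗g (suc n) = cong₂ _+_ (f≗g (suc n)) (partialSum-cong f≗g n)

  iterate-partialSum-cong : ∀ m {f g} → f ≗ g → iterate partialSum m f ≗ iterate partialSum m g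
  iterate-partialSum-cong zero    f≗g = f≗g
  iterate-partialSum-cong (suc m) f≗g = partialSum-cong (iterate-partialSum-cong m f≗g)

  partialSum-shift : ∀ f → partialSum (shift f) ≗ shift (partialSum f)
  partialSum-shift f zero          = refl
  partialSum-shift f (suc zero)    = ℕ.+-identityʳ (f 0)
  partialSum-shift f (suc (suc n)) = cong (f (suc n) +_) (partialSum-shift f (suc n))

  iterate-partialSum-shift : ∀ m f → iterate partialSum m (shift f) ≗ shift (iterate partialSum m f)
  iterate-partialSum-shift zero    f r = refl
  iterate-partialSum-shift (suc m) f r =
    trans (partialSum-cong (iterate-partialSum-shift m f) r) (partialSum-shift (iterate partialSum m f) r)

  vecDescents : Vec (Fin m) n → ℕ
  vecDescents []          = 0
  vecDescents (x ∷ [])    = 0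
  vecDescents (x ∷ y ∷ u) = if does (y Fin.<? x) then suc (vecDescents (y ∷ u)) else vecDescents (y ∷ u)

  length-filter-tabulate : ∀ {A B : Set} {P : A → Set} {Q : B → Set} (P? : Decidable P) (Q? : Decidable Q)
                           (f : Fin n → A) (g : Fin n → B) → (∀ i → does (P? (f i)) ≡ does (Q? (g i))) →
                           length (filter P? (tabulate f)) ≡ length (filter Q? (tabulate g))
  length-filter-tabulate {zero}  P? Q? f g eq = refl
  length-filter-tabulate {suc n} P? Q? f g eq
    with does (P? (f zero)) | does (Q? (g zero)) | eq zero
  ... | true  | _ | refl = cong suc (length-filter-tabulate P? Q? (f ∘ suc) (g ∘ suc) (eq ∘ suc))
  ... | false | _ | refl = length-filter-tabulate P? Q? (f ∘ suc) (g ∘ suc) (eq ∘ suc)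

  length-filter-descents : ∀ (u : Vec (Fin m) (suc n)) →
    length (filter (λ i → lookup u (suc i) Fin.<? lookup u (inject₁ i)) (allFin n)) ≡ vecDescents u
  length-filter-descents {n = zero} (x ∷ []) = refl
  length-filter-descents {n = suc n} (x ∷ y ∷ u)
    with does (y Fin.<? x)
       | trans (length-filter-tabulate (λ i → lookup (x ∷ y ∷ u) (suc i) Fin.<? lookup (x ∷ y ∷ u) (inject₁ i))
                  (λ i → lookup (y ∷ u) (suc i) Fin.<? lookup (y ∷ u) (inject₁ i)) suc id (λ _ → refl))
               (length-filter-descents (y ∷ u))
  ... | true  | eq = cong suc eq
  ... | false | eq = eq

  descents≡vecDescents : (π : Word n) → descents π ≡ vecDescents π
  descents≡vecDescents {zero}  [] = refl
  descents≡vecDescents {suc n} π  = length-filter-descents π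

  -- For injective u this says that w increases weakly, and strictly at the descents of u; quantifying over all
  -- pairs i < k makes it inherited by subwords.
  Compatible : Vec (Fin m) n → Vec ℕ n → Set
  Compatible u w = ∀ {i k} → i Fin.< k →
    lookup w i ≤ lookup w k × (lookup w i ≡ lookup w k → lookup u i Fin.≤ lookup u k)

  -- The least letter that may follow the letter a when x, and then u, are read.
  next : Fin m → ℕ → Vec (Fin m) n → ℕ
  next x a []      = a
  next x a (y ∷ u) = if does (y Fin.<? x) then suc a else a

  -- The form of `Compatible` that only compares adjacent letters. The letters can then be chosen
  -- from left to right, each bounded below by its predecessor alone, which makes counting
  -- recursive.
  Ladder : ℕ → ℕ → Vec (Fin m) n → Vec ℕ n → Set
  Ladder N lo []      []      = ⊤
  Ladder N lo (x ∷ u) (a ∷ w) = lo ≤ a × a < N × Ladder N (next x a u) u w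

  -- Letters never decrease along a ladder and rise at every descent. If `a` occurs again at `j`, no
  -- descent lies in between, and the letters of `u` are compared by transitivity.
  Ladder-head : ∀ {N a} (x : Fin m) (u : Vec (Fin m) n) (w : Vec ℕ n) → Ladder N (next x a u) u w →
                ∀ j → a ≤ lookup w j × (a ≡ lookup w j → x Fin.≤ lookup u j)
  Ladder-head {a = a} x (y ∷ u) (b ∷ w) (lo≤b , _ , rest) j with does (y Fin.<? x) | proof (y Fin.<? x) | j
  ... | true  | ofʸ y<x | zero  = ℕ.<⇒≤ lo≤b , λ { refl → ⊥-elim (ℕ.n≮n a lo≤b) }
  ... | true  | ofʸ y<x | suc j = ℕ.<⇒≤ a<wj , λ { refl → ⊥-elim (ℕ.n≮n a a<wj) }
    where a<wj = ℕ.<-≤-trans lo≤b (proj₁ (Ladder-head y u w rest j))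
  ... | false | ofⁿ y≮x | zero  = lo≤b , λ _ → ℕ.≮⇒≥ y≮x
  ... | false | ofⁿ y≮x | suc j with Ladder-head y u w rest j
  ...   | b≤wj , y≤uj = ℕ.≤-trans lo≤b b≤wj , λ { refl →
            ℕ.≤-trans (ℕ.≮⇒≥ y≮x) (y≤uj (ℕ.≤-antisym b≤wj lo≤b)) }

  Ladder⇒Compatible : ∀ {N lo} (u : Vec (Fin m) n) (w : Vec ℕ n) → Ladder N lo u w → Compatible u w
  Ladder⇒Compatible (x ∷ u) (a ∷ w) (_ , _ , rest) {zero}  {suc k} _         = Ladder-head x u w rest k
  Ladder⇒Compatible (x ∷ u) (a ∷ w) (_ , _ , rest) {suc i} {suc k} (s≤s i<k) = Ladder⇒Compatible u w rest i<k

  Ladder⇒< : ∀ {N lo} (u : Vec (Fin m) n) (w : Vec ℕ n) → Ladder N lo u w → ∀ i → lookup w i < N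
  Ladder⇒< (x ∷ u) (a ∷ w) (_ , a<N , rest) zero    = a<N
  Ladder⇒< (x ∷ u) (a ∷ w) (_ , a<N , rest) (suc i) = Ladder⇒< u w rest i

  Compatible⇒Ladder : ∀ {N lo} (u : Vec (Fin m) n) (w : Vec ℕ n) → Compatible u w →
                      (∀ i → lo ≤ lookup w i) → (∀ i → lookup w i < N) → Ladder N lo u w
  Compatible⇒Ladder []      []      comp lo≤ <N = tt
  Compatible⇒Ladder (x ∷ u) (a ∷ w) comp lo≤ <N =
    lo≤ zero , <N zero , Compatible⇒Ladder u w tailComp (lower u w comp) (<N ∘ suc)
    where
    tailComp : Compatible u w
    tailComp i<k = comp (s≤s i<k)
    lower : ∀ {n} (u : Vec (Fin _) n) (w : Vec ℕ n) → Compatible (x ∷ u) (a ∷ w) → ∀ j → next x a u ≤ lookup w j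
    lower (y ∷ u) (b ∷ w) comp j with does (y Fin.<? x) | proof (y Fin.<? x)
    ... | false | _       = proj₁ (comp {zero} {suc j} (s≤s z≤n))
    ... | true  | ofʸ y<x = ℕ.<-≤-trans (ℕ.≤∧≢⇒< (proj₁ a≤b) (λ a≡b → ℕ.<⇒≱ y<x (proj₂ a≤b a≡b))) (b≤ j)
      where
      a≤b = comp {zero} {suc zero} (s≤s z≤n)
      b≤ : ∀ j → b ≤ lookup (b ∷ w) j
      b≤ zero    = ℕ.≤-refl
      b≤ (suc j) = proj₁ (comp {suc zero} {suc (suc j)} (s≤s (s≤s z≤n)))

  -- If r letters of the alphabet exceed a, then room x r u letters are at least next x a u.
  room : Fin m → ℕ → Vec (Fin m) n → ℕ
  room x r []      = suc r
  room x r (y ∷ u) = if does (y Fin.<? x) then r else suc r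

  next+room : ∀ (x : Fin m) a r (u : Vec (Fin m) n) → next x a u + room x r u ≡ a + suc r
  next+room x a r []      = refl
  next+room x a r (y ∷ u) with does (y Fin.<? x)
  ... | true  = sym (ℕ.+-suc a r)
  ... | false = refl

  -- The first argument is the number of letters still available. The two summands separate the
  -- words that start with the least of them from the words that start higher.
  ladders : ℕ → Vec (Fin m) n → ℕ
  ladders r       []      = 1
  ladders zero    (x ∷ u) = 0
  ladders (suc r) (x ∷ u) = ladders (room x r u) u + ladders r (x ∷ u)

  HasCard-Ladder : ∀ {N lo} r (u : Vec (Fin m) n) → lo + r ≡ N → HasCard (Ladder N lo u) (ladders r u)
  HasCard-Ladder r [] eq = HasCard-singleton tt λ { {[]} _ → refl }
  HasCard-Ladder {lo = lo} zero (x ∷ u) refl = HasCard-empty λ { {a ∷ w} (lo≤a , a<N , _) →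
    ℕ.<⇒≱ a<N (subst (_≤ a) (sym (ℕ.+-identityʳ lo)) lo≤a) }
  HasCard-Ladder {N = N} {lo} (suc r) (x ∷ u) eq = HasCard-⊎
    {Q = λ { (a ∷ w) → a ≡ lo × Ladder N (next x lo u) u w }}
    (λ { {a ∷ w} (lo≤a , a<N , rest) → split lo≤a a<N rest })
    (λ { {a ∷ w} (refl , rest) → ℕ.≤-refl , lo<N , rest })
    (λ { {a ∷ w} (lo<a , a<N , rest) → ℕ.<⇒≤ lo<a , a<N , rest })
    (λ { {a ∷ w} (refl , _) (lo<a , _) → ℕ.n≮n lo lo<a })
    (HasCard-map (lo ∷_) (refl ,_) (λ { _ _ refl → refl }) (λ { {a ∷ w} (refl , rest) → w , rest , refl })
      (HasCard-Ladder (room x r u) u (trans (next+room x lo r u) eq)))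
    (HasCard-Ladder r (x ∷ u) (trans (sym (ℕ.+-suc lo r)) eq))
    where
    lo<N : lo < N
    lo<N = subst (lo <_) eq (ℕ.m<m+n lo (s≤s z≤n))
    split : ∀ {a w} → lo ≤ a → a < N → Ladder N (next x a u) u w →
            (a ≡ lo × Ladder N (next x lo u) u w) ⊎ Ladder N (suc lo) (x ∷ u) (a ∷ w)
    split lo≤a a<N rest with ℕ.m≤n⇒m<n∨m≡n lo≤a
    ... | inj₁ lo<a = inj₂ (lo<a , a<N , rest)
    ... | inj₂ refl = inj₁ (refl , rest)

  -- Choosing the first letter is a summation over its values, hence one more partial sum. A descent
  -- behind it uses up one letter, which shifts the argument by one, and shifts commute with partial
  -- sums.
  ladders≡partialSums : ∀ r (u : Vec (Fin m) n) →
    ladders (suc r) u ≡ iterate partialSum (suc n) (point (vecDescents u)) r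
  ladders≡partialSums zero [] = refl
  ladders≡partialSums {m} (suc r) [] = ladders≡partialSums {m} r []
  ladders≡partialSums {m} {suc n} r (x ∷ u) =
    trans (asSum r) (partialSum-cong (summand u (λ r → ladders≡partialSums r u)) r)
    where
    asSum : ∀ r → ladders (suc r) (x ∷ u) ≡ partialSum (λ r → ladders (room x r u) u) r
    asSum zero    = ℕ.+-identityʳ _
    asSum (suc r) = cong (ladders (room x (suc r) u) u +_) (asSum r)
    summand : ∀ {n} (u : Vec (Fin m) n) →
              (∀ r → ladders (suc r) u ≡ iterate partialSum (suc n) (point (vecDescents u)) r) →
              ∀ r → ladders (room x r u) u ≡ iterate partialSum (suc n) (point (vecDescents (x ∷ u))) r
    summand []              ih r = ih r
    summand {suc n} (y ∷ u) ih r with does (y Fin.<? x)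
    ... | false = ih r
    ... | true  = trans (drop r) (sym (iterate-partialSum-shift (2 + n) (point (vecDescents (y ∷ u))) r))
      where
      drop : ∀ r → ladders r (y ∷ u) ≡ shift (iterate partialSum (2 + n) (point (vecDescents (y ∷ u)))) r
      -- No letter is left behind a descent when `r` is 0; this agrees with the default value 0 of
      -- `shift`.
      drop zero    = refl
      drop (suc r) = ih r

  HasCard-Compatible : ∀ r (u : Vec (Fin m) n) →
    HasCard (λ w → Compatible u w × (∀ i → lookup w i < suc r))
            (iterate partialSum (suc n) (point (vecDescents u)) r)
  HasCard-Compatible r u = subst (HasCard _) (ladders≡partialSums r u) (HasCard-cong
    (λ {w} l → (λ {i} {k} → Ladder⇒Compatible u w l {i} {k}) , Ladder⇒< u w l)
    (λ {w} (comp , <N) → Compatible⇒Ladder u w comp (λ _ → z≤n) <N)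
    (HasCard-Ladder (suc r) u refl))

  -- Compatible pairs of an involution and a word

  Compatible-mono : ∀ (u : Vec (Fin m) n) (w : Vec ℕ n) → Compatible u w →
                    ∀ {i k} → i Fin.≤ k → lookup w i ≤ lookup w k
  Compatible-mono u w comp {i} {k} i≤k with ℕ.m≤n⇒m<n∨m≡n i≤k
  ... | inj₁ i<k = proj₁ (comp i<k)
  ... | inj₂ i≡k = ℕ.≤-reflexive (cong (lookup w) (Fin.toℕ-injective i≡k))

  -- What is left of a compatible pair with letters in {a, …, N-1} once all cycles joining a position labelled a
  -- to one labelled less than j are removed.
  record Restricted (N a j : ℕ) (π : Vec (Fin n) n) (w : Vec ℕ n) : Set where
    field
      involutive : ∀ i → lookup π (lookup π i) ≡ i
      compatible : Compatible π w
      lower      : ∀ i → a ≤ lookup w i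
      upper      : ∀ i → lookup w i < N
      partner    : ∀ i → lookup w i ≡ a → j ≤ lookup w (lookup π i)

  open Restricted

  Headed : ℕ → ℕ → Vec (Fin n) n → Vec ℕ n → Set
  Headed {zero}  a j π w = ⊥
  Headed {suc n} a j π w = lookup w zero ≡ a × lookup w (lookup π zero) ≡ j

  -- Whether a cycle with labels a and j exists is decided at position 0. If the label `a` occurs at
  -- all, it occurs there; among the positions labelled `a`, position 0 has the least image by
  -- compatibility, hence the least partner label.
  Restricted-split : ∀ {N a j} (π : Vec (Fin n) n) (w : Vec ℕ n) → Restricted N a j π w →
                     Restricted N a (suc j) π w ⊎ (Restricted N a j π w × Headed a j π w)
  Restricted-split {zero} π w g = inj₁ record
    { involutive = λ () ; compatible = λ { {()} } ; lower = λ () ; upper = λ () ; partner = λ () }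
  Restricted-split {suc n} {N} {a} {j} π w g with lookup w zero ℕ.≟ a
  ... | no w₀≢a = inj₁ record
    { involutive = involutive g ; compatible = λ {i} {k} → compatible g {i} {k} ; lower = lower g ; upper = upper g
    ; partner = λ i wi≡a → ⊥-elim (w₀≢a (ℕ.≤-antisym
        (subst (lookup w zero ≤_) wi≡a (Compatible-mono π w (compatible g) {zero} {i} z≤n)) (lower g zero))) }
  ... | yes w₀≡a with lookup w (lookup π zero) ℕ.≟ j
  ...   | yes eq = inj₂ (g , w₀≡a , eq)
  ...   | no neq = inj₁ record
    { involutive = involutive g ; compatible = λ {i} {k} → compatible g {i} {k} ; lower = lower g ; upper = upper g
    ; partner = λ i wi≡a → ℕ.<-≤-trans (ℕ.≤∧≢⇒< (partner g zero w₀≡a) (neq ∘ sym))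
        (Compatible-mono π w (compatible g) (least i wi≡a)) }
    where
    least : ∀ i → lookup w i ≡ a → lookup π zero Fin.≤ lookup π i
    least zero    _    = ℕ.≤-refl
    least (suc i) wi≡a = proj₂ (compatible g {zero} {suc i} (s≤s z≤n)) (trans w₀≡a (sym wi≡a))

  Restricted-weaken : ∀ {N a j} {π : Vec (Fin n) n} {w : Vec ℕ n} → Restricted N a (suc j) π w → Restricted N a j π w
  Restricted-weaken g = record
    { involutive = involutive g ; compatible = λ {i} {k} → compatible g {i} {k} ; lower = lower g ; upper = upper g
    ; partner = λ i wi≡a → ℕ.<⇒≤ (partner g i wi≡a) }

  Restricted⇒¬Headed : ∀ {N a j} (π : Vec (Fin n) n) (w : Vec ℕ n) → Restricted N a (suc j) π w → ¬ Headed a j π w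
  Restricted⇒¬Headed {suc n} π w g (w₀≡a , eq) = ℕ.<⇒≢ (partner g zero w₀≡a) (sym eq)

  -- Adjoining a fixed point at position 0

  map-preimage : ∀ {A B : Set} (f : A → B) (v : Vec B n) → (∀ k → ∃[ x ] lookup v k ≡ f x) → ∃[ v′ ] v ≡ Vec.map f v′
  map-preimage f []      h = [] , refl
  map-preimage f (y ∷ v) h with h zero | map-preimage f v (h ∘ suc)
  ... | x , refl | v′ , refl = x ∷ v′ , refl

  map-injective : ∀ {A B : Set} {f : A → B} → (∀ {x y} → f x ≡ f y → x ≡ y) →
                  {u v : Vec A n} → Vec.map f u ≡ Vec.map f v → u ≡ v
  map-injective inj {[]}    {[]}    eq = refl
  map-injective inj {x ∷ u} {y ∷ v} eq =
    cong₂ _∷_ (inj (Vec.∷-injectiveˡ eq)) (map-injective inj (Vec.∷-injectiveʳ eq))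

  insertFixed : ℕ → Vec (Fin n) n × Vec ℕ n → Vec (Fin (suc n)) (suc n) × Vec ℕ (suc n)
  insertFixed a (π , w) = zero ∷ Vec.map suc π , a ∷ w

  insertFixed-injective : ∀ {a} {x y : Vec (Fin n) n × Vec ℕ n} → insertFixed a x ≡ insertFixed a y → x ≡ y
  insertFixed-injective eq = cong₂ _,_
    (map-injective Fin.suc-injective (Vec.∷-injectiveʳ (cong proj₁ eq))) (Vec.∷-injectiveʳ (cong proj₂ eq))

  insertFixed⁺ : ∀ {N a} (π : Vec (Fin n) n) (w : Vec ℕ n) → a < N → Restricted N a a π w →
                 Restricted N a a (zero ∷ Vec.map suc π) (a ∷ w)
  insertFixed⁺ {n} {N} {a} π w a<N g = record
    { involutive = inv ; compatible = λ {i} {k} → comp i k ; lower = low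
    ; upper = λ { zero → a<N ; (suc i) → upper g i } ; partner = λ i _ → low (lookup (zero ∷ Vec.map suc π) i) }
    where
    inv : ∀ i → lookup (zero ∷ Vec.map suc π) (lookup (zero ∷ Vec.map suc π) i) ≡ i
    inv zero = refl
    inv (suc i) rewrite Vec.lookup-map i Fin.suc π | Vec.lookup-map (lookup π i) Fin.suc π = cong suc (involutive g i)
    low : ∀ i → a ≤ lookup (a ∷ w) i
    low zero    = ℕ.≤-refl
    low (suc i) = lower g i
    comp : ∀ i k → i Fin.< k → lookup (a ∷ w) i ≤ lookup (a ∷ w) k ×
      (lookup (a ∷ w) i ≡ lookup (a ∷ w) k →
       lookup (zero ∷ Vec.map suc π) i Fin.≤ lookup (zero ∷ Vec.map suc π) k)
    comp zero    (suc k) _ = lower g k , λ _ → z≤n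
    comp (suc i) (suc k) (s≤s i<k) rewrite Vec.lookup-map i Fin.suc π | Vec.lookup-map k Fin.suc π =
      proj₁ (compatible g i<k) , λ eq → s≤s (proj₂ (compatible g i<k) eq)

  insertFixed⁻ : ∀ {N a} (π : Vec (Fin n) n) (w : Vec ℕ n) →
                 Restricted N a a (zero ∷ Vec.map suc π) (a ∷ w) → Restricted N a a π w
  insertFixed⁻ {n} {N} {a} π w g = record
    { involutive = inv ; compatible = λ {i} {k} → comp i k ; lower = lower g ∘ suc
    ; upper = upper g ∘ suc ; partner = λ i _ → lower g (suc _) }
    where
    inv : ∀ i → lookup π (lookup π i) ≡ i
    inv i with involutive g (suc i)
    ... | eq rewrite Vec.lookup-map i Fin.suc π | Vec.lookup-map (lookup π i) Fin.suc π = Fin.suc-injective eq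
    comp : ∀ i k → i Fin.< k → lookup w i ≤ lookup w k × (lookup w i ≡ lookup w k → lookup π i Fin.≤ lookup π k)
    comp i k i<k with compatible g {suc i} {suc k} (s≤s i<k)
    ... | le , h rewrite Vec.lookup-map i Fin.suc π | Vec.lookup-map k Fin.suc π = le , λ eq → ℕ.s≤s⁻¹ (h eq)

  -- Here π 0 > 0 is impossible: as 0 and π 0 carry the same letter, it would give π 0 ≤ π (π 0) = 0.
  insertFixed-surjective : ∀ {N a} (π : Vec (Fin (suc n)) (suc n)) (w : Vec ℕ (suc n)) →
                           Restricted N a a π w → Headed a a π w →
                           ∃[ x ] Restricted N a a (proj₁ x) (proj₂ x) × insertFixed a x ≡ (π , w)
  insertFixed-surjective {a = a} (suc s ∷ π) (_ ∷ w) g (refl , eq)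
    with proj₂ (compatible g {zero} {suc s} (s≤s z≤n)) (sym eq)
  ... | le with lookup π s | involutive g zero | le
  ...   | .zero | refl | ()
  insertFixed-surjective {a = a} (zero ∷ π) (_ ∷ w) g (refl , eq) with map-preimage suc π nonzero
    where
    nonzero : ∀ k → ∃[ x ] lookup π k ≡ suc x
    nonzero k with lookup π k | involutive g (suc k)
    ... | suc x | _ = x , refl
  ... | π′ , refl = (π′ , w) , insertFixed⁻ π′ w g , refl

  -- Adjoining a two-cycle through position 0

  data At (p : Fin (suc n)) : Fin (suc n) → Set where
    here : At p p
    away : ∀ k → At p (punchIn p k)

  at : ∀ (p i : Fin (suc n)) → At p i
  at p i with p Fin.≟ i
  ... | yes refl = here
  ... | no p≢i   = subst (At p) (Fin.punchIn-punchOut p≢i) (away (punchOut p≢i))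

  punchIn-mono-< : ∀ (p : Fin (suc n)) {i k} → i Fin.< k → punchIn p i Fin.< punchIn p k
  punchIn-mono-< p {i} {k} i<k = ℕ.≰⇒> λ le → ℕ.<⇒≱ i<k (Fin.punchIn-cancel-≤ p k i le)

  punchIn-cancel-< : ∀ (p : Fin (suc n)) {i k} → punchIn p i Fin.< punchIn p k → i Fin.< k
  punchIn-cancel-< p {i} {k} lt = ℕ.≰⇒> λ le → ℕ.<⇒≱ lt (Fin.punchIn-mono-≤ p k i le)

  punchIn-below : ∀ (p : Fin (suc n)) {k} → toℕ k < toℕ p → punchIn p k Fin.< p
  punchIn-below (suc p) {zero}  _         = s≤s z≤n
  punchIn-below (suc p) {suc k} (s≤s k<p) = s≤s (punchIn-below p k<p)

  punchIn-above : ∀ (p : Fin (suc n)) {k} → toℕ p ≤ toℕ k → p Fin.< punchIn p k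
  punchIn-above zero            _         = s≤s z≤n
  punchIn-above (suc p) {suc k} (s≤s p≤k) = s≤s (punchIn-above p p≤k)

  -- Where the partner of the new position 0 has to go. It is labelled `j` and its image is 0, the
  -- least possible, so compatibility forces it in front of all other letters equal to `j`.
  position : ℕ → Vec ℕ n → Fin (suc n)
  position j []      = zero
  position j (b ∷ w) = if does (b ℕ.<? j) then suc (position j w) else zero

  position-below : ∀ {j} (w : Vec ℕ n) {k} → toℕ k < toℕ (position j w) → lookup w k < j
  position-below {j = j} (b ∷ w) {k} lt with does (b ℕ.<? j) | proof (b ℕ.<? j) | k | lt
  ... | true | ofʸ b<j | zero  | _        = b<j
  ... | true | ofʸ b<j | suc k | s≤s k<p = position-below w k<p

  position-above : ∀ {j} (w : Vec ℕ n) → (∀ {i k} → i Fin.≤ k → lookup w i ≤ lookup w k) →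
                   ∀ {k} → toℕ (position j w) ≤ toℕ k → j ≤ lookup w k
  position-above {j = j} (b ∷ w) mono {k} le with does (b ℕ.<? j) | proof (b ℕ.<? j) | k | le
  ... | false | ofⁿ b≮j | k     | _        = ℕ.≤-trans (ℕ.≮⇒≥ b≮j) (mono {zero} {k} z≤n)
  ... | true  | _       | suc k | s≤s p≤k = position-above w (λ {i} {k} i≤k → mono {suc i} {suc k} (s≤s i≤k)) p≤k

  position-unique : ∀ {j} (w : Vec ℕ n) (p : Fin (suc n)) → (∀ k → toℕ k < toℕ p → lookup w k < j) →
                    (∀ k → toℕ p ≤ toℕ k → j ≤ lookup w k) → p ≡ position j w
  position-unique {j = j} []      zero below above = refl
  position-unique {j = j} (b ∷ w) p below above with does (b ℕ.<? j) | proof (b ℕ.<? j) | p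
  ... | true  | ofʸ b<j | zero  = ⊥-elim (ℕ.<⇒≱ b<j (above zero z≤n))
  ... | false | ofⁿ b≮j | suc p = ⊥-elim (b≮j (below zero (s≤s z≤n)))
  ... | false | ofⁿ b≮j | zero  = refl
  ... | true  | ofʸ b<j | suc p =
    cong suc (position-unique w p (λ k lt → below (suc k) (s≤s lt)) (λ k le → above (suc k) (s≤s le)))

  away-suc : Fin (suc n) → Fin n → Fin (suc (suc n))
  away-suc p = suc ∘ punchIn p

  pairUp : Fin (suc n) → Vec (Fin n) n → Vec (Fin (2 + n)) (2 + n)
  pairUp p π = suc p ∷ insertAt (Vec.map (away-suc p) π) p zero

  lookup-pairUp : ∀ (p : Fin (suc n)) π k → lookup (pairUp p π) (away-suc p k) ≡ away-suc p (lookup π k)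
  lookup-pairUp p π k =
    trans (Vec.insertAt-punchIn (Vec.map (away-suc p) π) p zero k) (Vec.lookup-map k (away-suc p) π)

  insertPair : ℕ → ℕ → Vec (Fin n) n × Vec ℕ n → Vec (Fin (2 + n)) (2 + n) × Vec ℕ (2 + n)
  insertPair a j (π , w) = pairUp (position j w) π , a ∷ insertAt w (position j w) j

  away-suc-injective : ∀ (p : Fin (suc n)) {i k} → away-suc p i ≡ away-suc p k → i ≡ k
  away-suc-injective p eq = Fin.punchIn-injective p _ _ (Fin.suc-injective eq)

  insertAt-injective : ∀ {A : Set} {u v : Vec A n} (p : Fin (suc n)) {x : A} → insertAt u p x ≡ insertAt v p x → u ≡ v
  insertAt-injective {u = u} {v} p {x} eq =
    trans (sym (Vec.removeAt-insertAt u p x)) (trans (cong (λ t → removeAt t p) eq) (Vec.removeAt-insertAt v p x))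

  insertPair-injective : ∀ {a j} {x y : Vec (Fin n) n × Vec ℕ n} → insertPair a j x ≡ insertPair a j y → x ≡ y
  insertPair-injective {j = j} {π , w} {σ , v} eq
    with position j w | position j v | Fin.suc-injective (Vec.∷-injectiveˡ (cong proj₁ eq)) | eq
  ... | p | .p | refl | eq = cong₂ _,_
    (map-injective (away-suc-injective p) (insertAt-injective p (Vec.∷-injectiveʳ (cong proj₁ eq))))
    (insertAt-injective p (Vec.∷-injectiveʳ (cong proj₂ eq)))

  module _ {N a j : ℕ} (a<j : a < j) (j<N : j < N) (π : Vec (Fin n) n) (w : Vec ℕ n) where

    private
      p = position j w
      Π = pairUp p π
      W : Vec ℕ (2 + n)
      W = a ∷ insertAt w p j

    insertPair⁺ : Restricted N a j π w → Restricted N a j Π W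
    insertPair⁺ g = record
      { involutive = inv ; compatible = λ {i} {k} → comp i k ; lower = low ; upper = upp ; partner = part }
      where
      below : ∀ k → punchIn p k Fin.< p → lookup w k < j
      below k lt = position-below w (ℕ.≰⇒> λ p≤k → ℕ.<-asym lt (punchIn-above p p≤k))
      above : ∀ k → p Fin.< punchIn p k → j ≤ lookup w k
      above k lt = position-above w (Compatible-mono π w (compatible g))
        (ℕ.≮⇒≥ λ k<p → ℕ.<-asym lt (punchIn-below p k<p))
      inv : ∀ i → lookup Π (lookup Π i) ≡ i
      inv zero = Vec.insertAt-lookup (Vec.map (away-suc p) π) p zero
      inv (suc i) with at p i
      ... | here   = cong (lookup Π) (Vec.insertAt-lookup (Vec.map (away-suc p) π) p zero)
      ... | away k = trans (cong (lookup Π) (lookup-pairUp p π k))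
                       (trans (lookup-pairUp p π (lookup π k)) (cong (away-suc p) (involutive g k)))
      low : ∀ i → a ≤ lookup W i
      low zero = ℕ.≤-refl
      low (suc i) with at p i
      ... | here   rewrite Vec.insertAt-lookup w p j = ℕ.<⇒≤ a<j
      ... | away k rewrite Vec.insertAt-punchIn w p j k = lower g k
      upp : ∀ i → lookup W i < N
      upp zero = ℕ.<-trans a<j j<N
      upp (suc i) with at p i
      ... | here   rewrite Vec.insertAt-lookup w p j = j<N
      ... | away k rewrite Vec.insertAt-punchIn w p j k = upper g k
      part : ∀ i → lookup W i ≡ a → j ≤ lookup W (lookup Π i)
      part zero _ rewrite Vec.insertAt-lookup w p j = ℕ.≤-refl
      part (suc i) with at p i
      ... | here   rewrite Vec.insertAt-lookup w p j = λ j≡a → ⊥-elim (ℕ.<⇒≢ a<j (sym j≡a))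
      ... | away k rewrite lookup-pairUp p π k | Vec.insertAt-punchIn w p j k
                         | Vec.insertAt-punchIn w p j (lookup π k) = partner g k
      comp : ∀ i k → i Fin.< k →
             lookup W i ≤ lookup W k × (lookup W i ≡ lookup W k → lookup Π i Fin.≤ lookup Π k)
      comp zero (suc k) _ with at p k
      ... | here   rewrite Vec.insertAt-lookup w p j = ℕ.<⇒≤ a<j , λ a≡j → ⊥-elim (ℕ.<⇒≢ a<j a≡j)
      -- Another position labelled `a` has a partner labelled at least `j`, which therefore lies
      -- behind the inserted position: position 0 does have the least image among the positions
      -- labelled `a`.
      ... | away k rewrite lookup-pairUp p π k | Vec.insertAt-punchIn w p j k =
        lower g k , λ a≡wk → s≤s (ℕ.<⇒≤ (punchIn-above p (ℕ.≮⇒≥ λ πk<p →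
          ℕ.<⇒≱ (position-below w πk<p) (partner g k (sym a≡wk)))))
      comp (suc i) (suc k) (s≤s i<k) with at p i | at p k
      ... | here   | here   = ⊥-elim (ℕ.n≮n _ i<k)
      ... | here   | away k rewrite Vec.insertAt-lookup w p j | Vec.insertAt-lookup (Vec.map (away-suc p) π) p zero
                                  | Vec.insertAt-punchIn w p j k = above k i<k , λ _ → z≤n
      ... | away i | here   rewrite Vec.insertAt-lookup w p j | Vec.insertAt-punchIn w p j i =
        ℕ.<⇒≤ (below i i<k) , λ wi≡j → ⊥-elim (ℕ.<⇒≢ (below i i<k) wi≡j)
      ... | away i | away k rewrite lookup-pairUp p π i | lookup-pairUp p π k
                                  | Vec.insertAt-punchIn w p j i | Vec.insertAt-punchIn w p j k =
        let le , h = compatible g (punchIn-cancel-< p i<k)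
        in le , λ eq → s≤s (Fin.punchIn-mono-≤ p _ _ (h eq))

  module _ {N a j : ℕ} (p : Fin (suc n)) (π : Vec (Fin n) n) (w : Vec ℕ n)
           (g : Restricted N a j (pairUp p π) (a ∷ insertAt w p j)) where

    insertPair⁻ : Restricted N a j π w
    insertPair⁻ = record
      { involutive = λ k → away-suc-injective p (trans (sym (trans (cong (lookup (pairUp p π)) (lookup-pairUp p π k))
                             (lookup-pairUp p π (lookup π k)))) (involutive g (away-suc p k)))
      ; compatible = λ {i} {k} → comp i k
      ; lower      = λ k → subst (a ≤_) (Vec.insertAt-punchIn w p j k) (lower g (away-suc p k))
      ; upper      = λ k → subst (_< N) (Vec.insertAt-punchIn w p j k) (upper g (away-suc p k))
      ; partner    = part }
      where
      comp : ∀ i k → i Fin.< k → lookup w i ≤ lookup w k × (lookup w i ≡ lookup w k → lookup π i Fin.≤ lookup π k)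
      comp i k i<k with compatible g {away-suc p i} {away-suc p k} (s≤s (punchIn-mono-< p i<k))
      ... | le , h rewrite lookup-pairUp p π i | lookup-pairUp p π k
                         | Vec.insertAt-punchIn w p j i | Vec.insertAt-punchIn w p j k =
        le , λ eq → Fin.punchIn-cancel-≤ p _ _ (ℕ.s≤s⁻¹ (h eq))
      part : ∀ k → lookup w k ≡ a → j ≤ lookup w (lookup π k)
      part k wk≡a with partner g (away-suc p k)
      ... | h rewrite lookup-pairUp p π k | Vec.insertAt-punchIn w p j k
                    | Vec.insertAt-punchIn w p j (lookup π k) = h wk≡a

    -- An old letter equal to `j` on the left of the inserted one would need an image at most 0, but
    -- old positions have nonzero images. So `p` need not be stored: it is recovered from `w`.
    insertPair-position : p ≡ position j w
    insertPair-position = position-unique w p below above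
      where
      below : ∀ k → toℕ k < toℕ p → lookup w k < j
      below k k<p with compatible g {away-suc p k} {suc p} (s≤s (punchIn-below p k<p))
      ... | le , h rewrite lookup-pairUp p π k | Vec.insertAt-punchIn w p j k | Vec.insertAt-lookup w p j
                         | Vec.insertAt-lookup (Vec.map (away-suc p) π) p zero =
        ℕ.≤∧≢⇒< le λ eq → ℕ.n≮0 (h eq)
      above : ∀ k → toℕ p ≤ toℕ k → j ≤ lookup w k
      above k p≤k with compatible g {suc p} {away-suc p k} (s≤s (punchIn-above p p≤k))
      ... | le , h rewrite Vec.insertAt-punchIn w p j k | Vec.insertAt-lookup w p j = le

  insertPair-surjective : ∀ {N a j} → a < j → (π : Vec (Fin (2 + n)) (2 + n)) (w : Vec ℕ (2 + n)) →
                          Restricted N a j π w → Headed a j π w →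
                          ∃[ x ] Restricted N a j (proj₁ x) (proj₂ x) × insertPair a j x ≡ (π , w)
  insertPair-surjective a<j (zero ∷ π) (_ ∷ w) g (refl , refl) = ⊥-elim (ℕ.n≮n _ a<j)
  insertPair-surjective {n} {N} {a} {j} a<j (suc p ∷ π) (_ ∷ w) g (refl , wp≡j) =
    lemma (removeAt w p) (trans (sym (Vec.insertAt-removeAt w p)) (cong (insertAt (removeAt w p) p) wp≡j))
    where
    rest : ∃[ π′ ] removeAt π p ≡ Vec.map (away-suc p) π′
    rest = map-preimage (away-suc p) (removeAt π p) avoids
      where
      lookup-removeAt : ∀ k → lookup (removeAt π p) k ≡ lookup π (punchIn p k)
      lookup-removeAt k = trans (sym (Vec.insertAt-punchIn (removeAt π p) p (lookup π p) k))
        (cong (λ t → lookup t (punchIn p k)) (Vec.insertAt-removeAt π p))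
      avoids : ∀ k → ∃[ x ] lookup (removeAt π p) k ≡ away-suc p x
      -- The images 0 and `suc p` are already taken by `suc p` and 0, so the remaining positions are
      -- permuted among themselves.
      avoids k rewrite lookup-removeAt k with lookup π (punchIn p k) | involutive g (away-suc p k)
      ... | zero  | eq = ⊥-elim (Fin.punchInᵢ≢i p k (sym (Fin.suc-injective eq)))
      ... | suc y | eq with at p y
      ...   | away x = x , refl
      ...   | here with trans (sym (involutive g zero)) eq
      ...     | ()
    lemma : ∀ w′ → w ≡ insertAt w′ p j →
            ∃[ x ] Restricted N a j (proj₁ x) (proj₂ x) × insertPair a j x ≡ (suc p ∷ π , a ∷ w)
    lemma w′ refl with rest
    ... | π′ , eq = (π′ , w′) , insertPair⁻ p π′ w′ g′ ,
                    trans (cong (λ q → pairUp q π′ , a ∷ insertAt w′ q j) (sym (insertPair-position p π′ w′ g′)))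
                          (cong (λ t → (suc p ∷ t , a ∷ insertAt w′ p j)) (sym π≡))
      where
      π≡ : π ≡ insertAt (Vec.map (away-suc p) π′) p zero
      π≡ = trans (sym (Vec.insertAt-removeAt π p)) (cong₂ (λ t y → insertAt t p y) eq (involutive g zero))
      g′ = subst (λ t → Restricted N a j (suc p ∷ t) (a ∷ insertAt w′ p j)) π≡ g

  -- Counting restricted pairs, one matrix entry at a time

  RestrictedCount : ℕ → ℕ → ℕ → (ℕ → ℕ) → Set
  RestrictedCount N a j f = ∀ n → HasCard (λ ((π , w) : Vec (Fin n) n × Vec ℕ n) → Restricted N a j π w) (f n)

  module _ {N a j : ℕ} {f : ℕ → ℕ} (count : RestrictedCount N a (suc j) f) where

    private
      unheaded : (∀ π w → Restricted N a j π w → ¬ Headed a j π w) →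
                 HasCard (λ ((π , w) : Vec (Fin n) n × Vec ℕ n) → Restricted N a j π w) (f n)
      unheaded {n} ¬headed = HasCard-cong Restricted-weaken
        (λ { {π , w} g → only-inj₁ π w g (Restricted-split π w g) }) (count n)
        where
        only-inj₁ : ∀ π w → Restricted N a j π w → _ → Restricted N a (suc j) π w
        only-inj₁ π w g (inj₁ h)         = h
        only-inj₁ π w g (inj₂ (_ , hd)) = ⊥-elim (¬headed π w g hd)

      headed : ∀ {m} → HasCard (λ ((π , w) : Vec (Fin n) n × Vec ℕ n) → Restricted N a j π w × Headed a j π w) m →
               HasCard (λ ((π , w) : Vec (Fin n) n × Vec ℕ n) → Restricted N a j π w) (f n + m)
      headed {n} = HasCard-⊎ (λ { {π , w} → Restricted-split π w }) Restricted-weaken proj₁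
        (λ { {π , w} h (_ , hd) → Restricted⇒¬Headed π w h hd }) (count n)

    -- Removing the leading cycle with labels a and j leaves a pair that is still restricted by `j`,
    -- not by `suc j`, since the cycle may be repeated. Hence g (n+2) = f (n+2) + g n. In sizes 0
    -- and 1 there is no such cycle: a fixed point would force a = j.
    RestrictedCount-pair : a < j → j < N → RestrictedCount N a j (partialSum₂ f)
    RestrictedCount-pair a<j j<N zero          = unheaded λ _ _ _ ()
    RestrictedCount-pair a<j j<N (suc zero)    = unheaded λ { (zero ∷ []) _ _ (refl , refl) → ℕ.n≮n _ a<j }
    RestrictedCount-pair a<j j<N (suc (suc n)) = headed (HasCard-map (insertPair a j)
      (λ { {π , w} g → insertPair⁺ a<j j<N π w g , refl , Vec.insertAt-lookup w (position j w) j })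
      (λ _ _ → insertPair-injective)
      (λ { {π , w} (g , hd) → insertPair-surjective a<j π w g hd })
      (RestrictedCount-pair a<j j<N n))

    RestrictedCount-fixed : a ≡ j → a < N → RestrictedCount N a j (partialSum f)
    RestrictedCount-fixed refl a<N zero    = unheaded λ _ _ _ ()
    RestrictedCount-fixed refl a<N (suc n) = headed (HasCard-map (insertFixed a)
      (λ { {π , w} g → insertFixed⁺ π w a<N g , refl , refl })
      (λ _ _ → insertFixed-injective)
      (λ { {π , w} (g , hd) → insertFixed-surjective π w g hd })
      (RestrictedCount-fixed refl a<N n))

  -- The partner of a position labelled `a` would need a label at least `N`. So the letter `a` no
  -- longer occurs, row `a` of the matrix is exhausted, and the next row starts at its diagonal
  -- entry.
  RestrictedCount-next : ∀ {N a f} → RestrictedCount N (suc a) (suc a) f → RestrictedCount N a N f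
  RestrictedCount-next {N} {a} count n = HasCard-cong
    (λ { {π , w} g → record
      { involutive = involutive g ; compatible = λ {i} {k} → compatible g {i} {k}
      ; lower = λ i → ℕ.<⇒≤ (lower g i) ; upper = upper g
      ; partner = λ i wi≡a → ⊥-elim (ℕ.<⇒≢ (lower g i) (sym wi≡a)) } })
    (λ { {π , w} g → let above = λ i → ℕ.≤∧≢⇒< (lower g i) (λ a≡wi →
                                    ℕ.<⇒≱ (upper g (lookup π i)) (partner g i (sym a≡wi))) in record
      { involutive = involutive g ; compatible = λ {i} {k} → compatible g {i} {k}
      ; lower = above ; upper = upper g ; partner = λ i _ → above (lookup π i) } })
    (count n)

  RestrictedCount-pairs : ∀ {N a j f} d → a < j → j + d ≡ N → RestrictedCount N a N f →
                          RestrictedCount N a j (iterate partialSum₂ d f)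
  RestrictedCount-pairs {j = j} zero    a<j eq count rewrite trans (sym (ℕ.+-identityʳ j)) eq = count
  RestrictedCount-pairs {j = j} (suc d) a<j eq count = RestrictedCount-pair
    (RestrictedCount-pairs d (ℕ.m<n⇒m<1+n a<j) (trans (sym (ℕ.+-suc j d)) eq) count)
    a<j (subst (j <_) eq (ℕ.m<m+n j (s≤s z≤n)))

  -- Here `d` is the number of letters left. A row with `suc d` letters left has one diagonal entry
  -- and `d` entries to its right; with no letter left only the empty pair survives, whence `δ`.
  RestrictedCount-symmetricMatrices : ∀ {N a} d → a + d ≡ N → RestrictedCount N a a (symmetricMatrices d)
  RestrictedCount-symmetricMatrices zero eq zero = HasCard-singleton {a = Vec.[] , Vec.[]} record
    { involutive = λ () ; compatible = λ { {()} } ; lower = λ () ; upper = λ () ; partner = λ () }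
    λ { {[] , []} _ → refl }
  RestrictedCount-symmetricMatrices {a = a} zero refl (suc n) = HasCard-empty λ { {π , w} g →
    ℕ.<⇒≱ (upper g zero) (subst (_≤ lookup w zero) (sym (ℕ.+-identityʳ a)) (lower g zero)) }
  RestrictedCount-symmetricMatrices {a = a} (suc d) eq = RestrictedCount-fixed
    (RestrictedCount-pairs d ℕ.≤-refl a+d≡N (RestrictedCount-next (RestrictedCount-symmetricMatrices d a+d≡N)))
    refl (subst (a <_) eq (ℕ.m<m+n a (s≤s z≤n)))
    where
    a+d≡N = trans (sym (ℕ.+-suc a d)) eq

  -- Partial sums of the rows

  partialSum-+ : ∀ f g → partialSum (λ k → f k + g k) ≗ λ k → partialSum f k + partialSum g k
  partialSum-+ f g zero    = refl
  partialSum-+ f g (suc n) = trans (cong (f (suc n) + g (suc n) +_) (partialSum-+ f g n))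
    (interchange (f (suc n)) (g (suc n)) (partialSum f n) (partialSum g n))
    where
    interchange : ∀ a b c d → a + b + (c + d) ≡ a + c + (b + d)
    interchange = solve-∀

  iterate-partialSum-+ : ∀ m f g → iterate partialSum m (λ k → f k + g k) ≗
                                   λ k → iterate partialSum m f k + iterate partialSum m g k
  iterate-partialSum-+ zero    f g r = refl
  iterate-partialSum-+ (suc m) f g r = trans (partialSum-cong (iterate-partialSum-+ m f g) r)
    (partialSum-+ (iterate partialSum m f) (iterate partialSum m g) r)

  iterate-partialSum-0 : ∀ m r → iterate partialSum m (λ _ → 0) r ≡ 0
  iterate-partialSum-0 zero    r = refl
  iterate-partialSum-0 (suc m) r = trans (partialSum-cong (iterate-partialSum-0 m) r) (zeros r)
    where
    zeros : ∀ r → partialSum (λ _ → 0) r ≡ 0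
    zeros zero    = refl
    zeros (suc r) = zeros r

  iterate-partialSum-sum : ∀ m (f : A → ℕ → ℕ) xs r →
    iterate partialSum m (λ j → sum (map (λ x → f x j) xs)) r ≡ sum (map (λ x → iterate partialSum m (f x) r) xs)
  iterate-partialSum-sum m f []       r = iterate-partialSum-0 m r
  iterate-partialSum-sum m f (x ∷ xs) r =
    trans (iterate-partialSum-+ m (f x) (λ j → sum (map (λ x → f x j) xs)) r)
          (cong (iterate partialSum m (f x) r +_) (iterate-partialSum-sum m f xs r))

  length-filter-×-dec : ∀ {P Q : A → Set} (P? : Decidable P) (Q? : Decidable Q) xs →
    length (filter (λ x → P? x ×-dec Q? x) xs) ≡ length (filter Q? (filter P? xs))
  length-filter-×-dec P? Q? []       = refl
  length-filter-×-dec P? Q? (x ∷ xs) with does (P? x)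
  ... | false = length-filter-×-dec P? Q? xs
  ... | true with does (Q? x)
  ...   | true  = cong suc (length-filter-×-dec P? Q? xs)
  ...   | false = length-filter-×-dec P? Q? xs

  point-≟ : ∀ k j → point k j ≡ (if does (k ℕ.≟ j) then 1 else 0)
  point-≟ zero    zero    = refl
  point-≟ zero    (suc j) = refl
  point-≟ (suc k) zero    = refl
  point-≟ (suc k) (suc j) = point-≟ k j

  length-filter-≟ : ∀ (f : A → ℕ) xs j → length (filter (λ x → f x ℕ.≟ j) xs) ≡ sum (map (λ x → point (f x) j) xs)
  length-filter-≟ f []       j = refl
  length-filter-≟ f (x ∷ xs) j with does (f x ℕ.≟ j) | point-≟ (f x) j
  ... | true  | eq = cong₂ _+_ (sym eq) (length-filter-≟ f xs j)
  ... | false | eq = cong₂ _+_ (sym eq) (length-filter-≟ f xs j)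

  ∈-allVecs : ∀ {m n} (v : Vec (Fin m) n) → v ∈ allVecs m n
  ∈-allVecs []      = here refl
  ∈-allVecs (x ∷ v) = ∈-cartesianProductWith⁺ _∷_ (∈-allFin x) (∈-allVecs v)

  allVecs-unique : ∀ m n → Unique (allVecs m n)
  allVecs-unique m zero    = All.[] AllPairs.∷ AllPairs.[]
  allVecs-unique m (suc n) = Unique.cartesianProductWith⁺ _∷_ Vec.∷-injective (Unique.allFin⁺ m) (allVecs-unique m n)

  involutions : ∀ n → List (Word n)
  involutions n = filter isInvolution? (allVecs n n)

  I≡sum : ∀ n j → I n j ≡ sum (map (λ π → point (descents π) j) (involutions n))
  I≡sum n j = trans (length-filter-×-dec isInvolution? (λ π → descents π ℕ.≟ j) (allVecs n n))
    (length-filter-≟ descents (involutions n) j)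

  -- Double counting of the compatible pairs with `suc r` letters. Grouping by the involution gives
  -- the left side; the right side counts `Restricted (suc r) 0 0`, where the conditions `lower` and
  -- `partner` are vacuous.
  partialSums-I : ∀ n r → iterate partialSum (suc n) (I n) r ≡ symmetricMatrices (suc r) n
  partialSums-I n r = begin
    iterate partialSum (suc n) (I n) r
      ≡⟨ iterate-partialSum-cong (suc n) (I≡sum n) r ⟩
    iterate partialSum (suc n) (λ j → sum (map (λ π → point (descents π) j) (involutions n))) r
      ≡⟨ iterate-partialSum-sum (suc n) (λ π → point (descents π)) (involutions n) r ⟩
    sum (map (λ π → iterate partialSum (suc n) (point (descents π)) r) (involutions n))
      ≡⟨ HasCard-unique byWord (RestrictedCount-symmetricMatrices {a = 0} (suc r) refl n) ⟩
    symmetricMatrices (suc r) n ∎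
    where
    byWord = HasCard-cong
      (λ { {π , w} (π∈ , comp , w≤r) → record
        { involutive = proj₂ (proj₂ (∈-filter⁻ isInvolution? {xs = allVecs n n} π∈))
        ; compatible = λ {i} {k} → comp {i} {k} ; lower = λ _ → z≤n ; upper = w≤r ; partner = λ _ _ → z≤n } })
      (λ { {π , w} g → ∈-filter⁺ isInvolution? (∈-allVecs π)
          ((λ {i} {k} eq → trans (sym (involutive g i)) (trans (cong (lookup π) eq) (involutive g k))) , involutive g) ,
        (λ {i} {k} → compatible g {i} {k}) , upper g })
      (HasCard-Σ {Q = λ π w → Compatible π w × (∀ i → lookup w i < suc r)}
        (λ π → iterate partialSum (suc n) (point (descents π)) r)
        (Unique.filter⁺ isInvolution? (allVecs-unique n n))
        (λ {π} _ → subst (λ d → HasCard (λ w → Compatible π w × (∀ i → lookup w i < suc r)) (iterate partialSum (suc n) (point d) r))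
          (sym (descents≡vecDescents π)) (HasCard-Compatible r π)))

  descents< : ∀ {n} (π : Word (suc n)) → descents π < suc n
  descents< {n} π = s≤s (subst (descents π ≤_) (List.length-tabulate {n = n} (λ i → i))
    (List.length-filter (isDescent? π) (allFin n)))

  I-vanishes : ∀ n j → suc n ≤ j → I (suc n) j ≡ 0
  I-vanishes n j n<j = cong length (List.filter-none (λ π → isInvolution? π ×-dec (descents π ℕ.≟ j))
    (All.tabulate {xs = allVecs (suc n) (suc n)}
      λ { {π} _ (_ , eq) → ℕ.<⇒≱ (descents< π) (subst (suc n ≤_) (sym eq) n<j) }))

module Rows where

  open Counting
  open import Data.Integer using (+_; _+_; _*_; _-_; -_; _≤_; +≤+; 0ℤ; 1ℤ)
  open import Data.Integer.Tactic.RingSolver using (solve-∀)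
  open ≡-Reasoning

  -- The recurrence for the rows

  Σℤ : (ℕ → ℤ) → ℕ → ℤ
  Σℤ x zero    = x zero
  Σℤ x (suc r) = x (suc r) + Σℤ x r

  shiftℤ : (ℕ → ℤ) → ℕ → ℤ
  shiftℤ x zero    = 0ℤ
  shiftℤ x (suc k) = x k

  ∇ : (ℕ → ℤ) → ℕ → ℤ
  ∇ x k = x k - shiftℤ x k

  -- What multiplication by r + 1 becomes once the partial sums are undone. On the row of Eulerian
  -- numbers of [n], `Λ (suc n)` is the classical recurrence producing the row of [n+1].
  Λ : ℕ → (ℕ → ℤ) → ℕ → ℤ
  Λ m x k = (1ℤ + + k) * x k + (+ m - + k) * shiftℤ x k

  Σℤ-cong : ∀ {x y} → x ≗ y → Σℤ x ≗ Σℤ y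
  Σℤ-cong eq zero    = eq zero
  Σℤ-cong eq (suc r) = cong₂ _+_ (eq (suc r)) (Σℤ-cong eq r)

  Σℤ-+ : ∀ x y → Σℤ (λ k → x k + y k) ≗ λ r → Σℤ x r + Σℤ y r
  Σℤ-+ x y zero    = refl
  Σℤ-+ x y (suc r) = trans (cong (_+_ (x (suc r) + y (suc r))) (Σℤ-+ x y r)) (interchange (x (suc r)) (y (suc r)) (Σℤ x r) (Σℤ y r))
    where
    interchange : ∀ a b c d → a + b + (c + d) ≡ a + c + (b + d)
    interchange = solve-∀

  Σℤ-* : ∀ c x → Σℤ (λ k → c * x k) ≗ λ r → c * Σℤ x r
  Σℤ-* c x zero    = refl
  Σℤ-* c x (suc r) = trans (cong (_+_ (c * x (suc r))) (Σℤ-* c x r)) (sym (ℤ.*-distribˡ-+ c (x (suc r)) (Σℤ x r)))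

  Σℤ-shiftℤ : ∀ x → Σℤ (shiftℤ x) ≗ shiftℤ (Σℤ x)
  Σℤ-shiftℤ x zero          = refl
  Σℤ-shiftℤ x (suc zero)    = ℤ.+-identityʳ (x 0)
  Σℤ-shiftℤ x (suc (suc r)) = cong (_+_ (x (suc r))) (Σℤ-shiftℤ x (suc r))

  shiftℤ-cong : ∀ {x y} → x ≗ y → shiftℤ x ≗ shiftℤ y
  shiftℤ-cong eq zero    = refl
  shiftℤ-cong eq (suc k) = eq k

  Σℤ-∇ : ∀ x → Σℤ (∇ x) ≗ x
  Σℤ-∇ x zero    = ℤ.+-identityʳ (x 0)
  Σℤ-∇ x (suc r) = trans (cong (_+_ (∇ x (suc r))) (Σℤ-∇ x r)) (telescope (x (suc r)) (x r))
    where
    telescope : ∀ a b → a - b + b ≡ a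
    telescope = solve-∀

  ∇-Σℤ : ∀ x → ∇ (Σℤ x) ≗ x
  ∇-Σℤ x zero    = ℤ.+-identityʳ (x 0)
  ∇-Σℤ x (suc r) = cancel (x (suc r)) (Σℤ x r)
    where
    cancel : ∀ a b → a + b - b ≡ a
    cancel = solve-∀

  Σℤ-injective : ∀ {x y} → Σℤ x ≗ Σℤ y → x ≗ y
  Σℤ-injective {x} {y} eq k = begin
    x k         ≡⟨ ∇-Σℤ x k ⟨
    ∇ (Σℤ x) k  ≡⟨ cong₂ _-_ (eq k) (shiftℤ-cong eq k) ⟩
    ∇ (Σℤ y) k  ≡⟨ ∇-Σℤ y k ⟩
    y k         ∎

  Σⁿ : ℕ → (ℕ → ℤ) → ℕ → ℤ
  Σⁿ = iterate Σℤ

  Σⁿ-cong : ∀ m {x y} → x ≗ y → Σⁿ m x ≗ Σⁿ m y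
  Σⁿ-cong zero    eq = eq
  Σⁿ-cong (suc m) eq = Σℤ-cong (Σⁿ-cong m eq)

  Σⁿ-+ : ∀ m x y → Σⁿ m (λ k → x k + y k) ≗ λ r → Σⁿ m x r + Σⁿ m y r
  Σⁿ-+ zero    x y r = refl
  Σⁿ-+ (suc m) x y r = trans (Σℤ-cong (Σⁿ-+ m x y) r) (Σℤ-+ (Σⁿ m x) (Σⁿ m y) r)

  Σⁿ-* : ∀ m c x → Σⁿ m (λ k → c * x k) ≗ λ r → c * Σⁿ m x r
  Σⁿ-* zero    c x r = refl
  Σⁿ-* (suc m) c x r = trans (Σℤ-cong (Σⁿ-* m c x) r) (Σℤ-* c (Σⁿ m x) r)

  Σⁿ-shiftℤ : ∀ m x → Σⁿ m (shiftℤ x) ≗ shiftℤ (Σⁿ m x)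
  Σⁿ-shiftℤ zero    x r = refl
  Σⁿ-shiftℤ (suc m) x r = trans (Σℤ-cong (Σⁿ-shiftℤ m x) r) (Σℤ-shiftℤ (Σⁿ m x) r)

  Σⁿ-∇ : ∀ m x → Σⁿ (suc m) (∇ x) ≗ Σⁿ m x
  Σⁿ-∇ zero    x = Σℤ-∇ x
  Σⁿ-∇ (suc m) x = Σℤ-cong (Σⁿ-∇ m x)

  Σⁿ-injective : ∀ m {x y} → Σⁿ m x ≗ Σⁿ m y → x ≗ y
  Σⁿ-injective zero    eq = eq
  Σⁿ-injective (suc m) eq = Σⁿ-injective m (Σℤ-injective eq)

  Σⁿ-pos : ∀ m f r → Σⁿ m (λ k → + f k) r ≡ + iterate partialSum m f r
  Σⁿ-pos zero    f r = refl
  Σⁿ-pos (suc m) f r = trans (Σℤ-cong (Σⁿ-pos m f) r) (go (iterate partialSum m f) r)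
    where
    go : ∀ f r → Σℤ (λ k → + f k) r ≡ + partialSum f r
    go f zero    = refl
    go f (suc r) = cong (_+_ (+ f (suc r))) (go f r)

  -- With E the shift and θ multiplication by the index, θ Σᵐ = Σᵐ θ + m E Σᵐ⁺¹.
  Σⁿ-Λ : ∀ m x r → (1ℤ + + r) * Σⁿ m x r ≡ Σⁿ (suc m) (Λ m x) r
  Σⁿ-Λ zero    x zero    = base (x 0)
    where
    base : ∀ a → (1ℤ + 0ℤ) * a ≡ (1ℤ + 0ℤ) * a + (0ℤ - 0ℤ) * 0ℤ
    base = solve-∀
  Σⁿ-Λ zero    x (suc r) = trans (telescope (+ r) (x (suc r)) (x r)) (cong (_+_ (Λ 0 x (suc r))) (Σⁿ-Λ zero x r))
    where
    telescope : ∀ k a b → (1ℤ + (1ℤ + k)) * a ≡ (1ℤ + (1ℤ + k)) * a + (0ℤ - (1ℤ + k)) * b + (1ℤ + k) * b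
    telescope = solve-∀
  Σⁿ-Λ (suc m) x r = begin
    (1ℤ + + r) * Σℤ (Σⁿ m x) r
      ≡⟨ leibniz (Σⁿ m x) r ⟩
    Σℤ (λ k → (1ℤ + + k) * Σⁿ m x k) r + shiftℤ (Σⁿ (2 ℕ.+ m) x) r
      ≡⟨ cong₂ _+_ (Σℤ-cong (Σⁿ-Λ m x) r) (sym (Σⁿ-shiftℤ (2 ℕ.+ m) x r)) ⟩
    Σⁿ (2 ℕ.+ m) (Λ m x) r + Σⁿ (2 ℕ.+ m) (shiftℤ x) r
      ≡⟨ Σⁿ-+ (2 ℕ.+ m) (Λ m x) (shiftℤ x) r ⟨
    Σⁿ (2 ℕ.+ m) (λ k → Λ m x k + shiftℤ x k) r
      ≡⟨ Σⁿ-cong (2 ℕ.+ m) (λ k → absorb (+ m) (+ k) (x k) (shiftℤ x k)) r ⟩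
    Σⁿ (2 ℕ.+ m) (Λ (suc m) x) r ∎
    where
    absorb : ∀ m k a b → (1ℤ + k) * a + (m - k) * b + b ≡ (1ℤ + k) * a + (1ℤ + m - k) * b
    absorb = solve-∀
    leibniz : ∀ y r → (1ℤ + + r) * Σℤ y r ≡ Σℤ (λ k → (1ℤ + + k) * y k) r + shiftℤ (Σℤ (Σℤ y)) r
    leibniz y zero    = sym (ℤ.+-identityʳ _)
    leibniz y (suc r) = begin
      (1ℤ + (1ℤ + + r)) * (y (suc r) + Σℤ y r)
        ≡⟨ split (+ r) (y (suc r)) (Σℤ y r) ⟩
      (1ℤ + (1ℤ + + r)) * y (suc r) + ((1ℤ + + r) * Σℤ y r + Σℤ y r)
        ≡⟨ cong (λ t → (1ℤ + (1ℤ + + r)) * y (suc r) + (t + Σℤ y r)) (leibniz y r) ⟩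
      (1ℤ + (1ℤ + + r)) * y (suc r) + (Σℤ (λ k → (1ℤ + + k) * y k) r + shiftℤ (Σℤ (Σℤ y)) r + Σℤ y r)
        ≡⟨ regroup ((1ℤ + (1ℤ + + r)) * y (suc r)) (Σℤ (λ k → (1ℤ + + k) * y k) r) (shiftℤ (Σℤ (Σℤ y)) r) (Σℤ y r) ⟩
      Σℤ (λ k → (1ℤ + + k) * y k) (suc r) + (Σℤ y r + shiftℤ (Σℤ (Σℤ y)) r)
        ≡⟨ cong (_+_ (Σℤ (λ k → (1ℤ + + k) * y k) (suc r))) (unfold r) ⟩
      Σℤ (λ k → (1ℤ + + k) * y k) (suc r) + Σℤ (Σℤ y) r ∎
      where
      split : ∀ k a b → (1ℤ + (1ℤ + k)) * (a + b) ≡ (1ℤ + (1ℤ + k)) * a + ((1ℤ + k) * b + b)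
      split = solve-∀
      regroup : ∀ a b c d → a + (b + c + d) ≡ a + b + (d + c)
      regroup = solve-∀
      unfold : ∀ r → Σℤ y r + shiftℤ (Σℤ (Σℤ y)) r ≡ Σℤ (Σℤ y) r
      unfold zero    = ℤ.+-identityʳ _
      unfold (suc r) = refl

  shiftℤ-Λ : ∀ m x k → shiftℤ (Λ m x) k ≡ + k * shiftℤ x k + (+ m - + k + 1ℤ) * shiftℤ (shiftℤ x) k
  shiftℤ-Λ m x zero    = zeros (+ m)
    where
    zeros : ∀ m → 0ℤ ≡ 0ℤ * 0ℤ + (m - 0ℤ + 1ℤ) * 0ℤ
    zeros = solve-∀
  shiftℤ-Λ m x (suc k) = reindex (+ m) (+ k) (x k) (shiftℤ x k)
    where
    reindex : ∀ m k a b → (1ℤ + k) * a + (m - k) * b ≡ (1ℤ + k) * a + (m - (1ℤ + k) + 1ℤ) * b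
    reindex = solve-∀

  shiftℤ-∇ : ∀ x k → shiftℤ (∇ x) k ≡ shiftℤ x k - shiftℤ (shiftℤ x) k
  shiftℤ-∇ x zero    = refl
  shiftℤ-∇ x (suc k) = refl


  Iℤ : ℕ → ℕ → ℤ
  Iℤ n k = + I n k

  -- The recurrence of `symmetricMatrices (suc r)` has coefficients r + 1 and (r + 1)² + n. To
  -- compare rows, every term is written with 3 + n partial sums: each factor r + 1 supplies one
  -- through `Λ`, and the term with factor n, which lacks two, is padded by two `∇`.
  Iℤ-recurrence-Λ : ∀ n k → + (2 ℕ.+ n) * Iℤ (2 ℕ.+ n) k ≡
    Λ (2 ℕ.+ n) (Iℤ (1 ℕ.+ n)) k + Λ (2 ℕ.+ n) (Λ (1 ℕ.+ n) (Iℤ n)) k + + n * ∇ (∇ (Iℤ n)) k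
  Iℤ-recurrence-Λ n = Σⁿ-injective (3 ℕ.+ n) λ r → begin
    Σⁿ (3 ℕ.+ n) (λ k → + (2 ℕ.+ n) * Iℤ (2 ℕ.+ n) k) r
      ≡⟨ Σⁿ-* (3 ℕ.+ n) (+ (2 ℕ.+ n)) (Iℤ (2 ℕ.+ n)) r ⟩
    + (2 ℕ.+ n) * Σⁿ (3 ℕ.+ n) (Iℤ (2 ℕ.+ n)) r
      ≡⟨ transformed r ⟩
    (1ℤ + + r) * Σⁿ (2 ℕ.+ n) (Iℤ (1 ℕ.+ n)) r + ((1ℤ + + r) * (1ℤ + + r) + + n) * Σⁿ (1 ℕ.+ n) (Iℤ n) r
      ≡⟨ regroup (1ℤ + + r) (+ n) (Σⁿ (2 ℕ.+ n) (Iℤ (1 ℕ.+ n)) r) (Σⁿ (1 ℕ.+ n) (Iℤ n) r) ⟩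
    (1ℤ + + r) * Σⁿ (2 ℕ.+ n) (Iℤ (1 ℕ.+ n)) r + (1ℤ + + r) * ((1ℤ + + r) * Σⁿ (1 ℕ.+ n) (Iℤ n) r)
      + + n * Σⁿ (1 ℕ.+ n) (Iℤ n) r
      ≡⟨ cong₂ _+_ (cong₂ _+_ (Σⁿ-Λ (2 ℕ.+ n) (Iℤ (1 ℕ.+ n)) r)
           (trans (cong ((1ℤ + + r) *_) (Σⁿ-Λ (1 ℕ.+ n) (Iℤ n) r)) (Σⁿ-Λ (2 ℕ.+ n) (Λ (1 ℕ.+ n) (Iℤ n)) r)))
           (cong (+ n *_) (sym (trans (Σⁿ-∇ (2 ℕ.+ n) (∇ (Iℤ n)) r) (Σⁿ-∇ (1 ℕ.+ n) (Iℤ n) r)))) ⟩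
    Σⁿ (3 ℕ.+ n) f r + Σⁿ (3 ℕ.+ n) g r + + n * Σⁿ (3 ℕ.+ n) (∇ (∇ (Iℤ n))) r
      ≡⟨ cong₂ _+_ (Σⁿ-+ (3 ℕ.+ n) f g r) (Σⁿ-* (3 ℕ.+ n) (+ n) (∇ (∇ (Iℤ n))) r) ⟨
    Σⁿ (3 ℕ.+ n) (λ k → f k + g k) r + Σⁿ (3 ℕ.+ n) h r
      ≡⟨ Σⁿ-+ (3 ℕ.+ n) (λ k → f k + g k) h r ⟨
    Σⁿ (3 ℕ.+ n) (λ k → f k + g k + h k) r ∎
    where
    f = Λ (2 ℕ.+ n) (Iℤ (1 ℕ.+ n))
    g = Λ (2 ℕ.+ n) (Λ (1 ℕ.+ n) (Iℤ n))
    h = λ k → + n * ∇ (∇ (Iℤ n)) k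
    regroup : ∀ p n a b → p * a + (p * p + n) * b ≡ p * a + p * (p * b) + n * b
    regroup = solve-∀
    Σⁿ-I : ∀ n r → Σⁿ (suc n) (Iℤ n) r ≡ + symmetricMatrices (suc r) n
    Σⁿ-I n r = trans (Σⁿ-pos (suc n) (I n) r) (cong +_ (partialSums-I n r))
    transformed : ∀ r → + (2 ℕ.+ n) * Σⁿ (3 ℕ.+ n) (Iℤ (2 ℕ.+ n)) r ≡
      (1ℤ + + r) * Σⁿ (2 ℕ.+ n) (Iℤ (1 ℕ.+ n)) r + ((1ℤ + + r) * (1ℤ + + r) + + n) * Σⁿ (1 ℕ.+ n) (Iℤ n) r
    transformed r rewrite Σⁿ-I (2 ℕ.+ n) r | Σⁿ-I (1 ℕ.+ n) r | Σⁿ-I n r = begin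
      + (2 ℕ.+ n) * + s₂
        ≡⟨ ℤ.pos-* (2 ℕ.+ n) s₂ ⟨
      + ((2 ℕ.+ n) ℕ.* s₂)
        ≡⟨ cong +_ (Recurrent.step (symmetricMatrices-recurrent (suc r)) n) ⟩
      + (suc r ℕ.* s₁) + + ((suc r ℕ.* suc r ℕ.+ n) ℕ.* s₀)
        ≡⟨ cong₂ _+_ (ℤ.pos-* (suc r) s₁) (trans (ℤ.pos-* (suc r ℕ.* suc r ℕ.+ n) s₀)
             (cong (λ t → (t + + n) * + s₀) (ℤ.pos-* (suc r) (suc r)))) ⟩
      (1ℤ + + r) * + s₁ + ((1ℤ + + r) * (1ℤ + + r) + + n) * + s₀ ∎
      where
      s₀ = symmetricMatrices (suc r) n
      s₁ = symmetricMatrices (suc r) (1 ℕ.+ n)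
      s₂ = symmetricMatrices (suc r) (2 ℕ.+ n)

  -- `a`, `a₁` are the entries k, k-1 of row n+1, and `b`, `b₁`, `b₂` the entries k, k-1, k-2 of row
  -- n. With free integers in their place, symmetry becomes a polynomial identity.
  recurrenceRHS : (n k a a₁ b b₁ b₂ : ℤ) → ℤ
  recurrenceRHS n k a a₁ b b₁ b₂ =
      (1ℤ + k) * a + (+ 2 + n - k) * a₁
    + (((1ℤ + k) * (1ℤ + k) + n) * b
       + (+ 2 * k * (1ℤ + n - k) - n + 1ℤ) * b₁
       + ((+ 2 + n - k) * (+ 2 + n - k) + n) * b₂)

  Iℤ-recurrence : ∀ n k → + (2 ℕ.+ n) * Iℤ (2 ℕ.+ n) k ≡
    recurrenceRHS (+ n) (+ k) (Iℤ (1 ℕ.+ n) k) (shiftℤ (Iℤ (1 ℕ.+ n)) k)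
      (Iℤ n k) (shiftℤ (Iℤ n) k) (shiftℤ (shiftℤ (Iℤ n)) k)
  Iℤ-recurrence n k = trans (Iℤ-recurrence-Λ n k)
    (trans (cong₂ (λ s t → Λ (2 ℕ.+ n) (Iℤ (1 ℕ.+ n)) k
                           + ((1ℤ + + k) * Λ (1 ℕ.+ n) (Iℤ n) k + (+ (2 ℕ.+ n) - + k) * s)
                           + + n * (∇ (Iℤ n) k - t))
                 (shiftℤ-Λ (1 ℕ.+ n) (Iℤ n) k) (shiftℤ-∇ (Iℤ n) k))
      (expand (+ n) (+ k) (Iℤ (1 ℕ.+ n) k) (shiftℤ (Iℤ (1 ℕ.+ n)) k)
        (Iℤ n k) (shiftℤ (Iℤ n) k) (shiftℤ (shiftℤ (Iℤ n)) k)))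
    where
    expand : ∀ n k a a₁ b b₁ b₂ →
      (1ℤ + k) * a + (+ 2 + n - k) * a₁
      + ((1ℤ + k) * ((1ℤ + k) * b + (1ℤ + n - k) * b₁)
         + (+ 2 + n - k) * (k * b₁ + (1ℤ + n - k + 1ℤ) * b₂))
      + n * (b - b₁ - (b₁ - b₂))
      ≡ (1ℤ + k) * a + (+ 2 + n - k) * a₁
        + (((1ℤ + k) * (1ℤ + k) + n) * b
           + (+ 2 * k * (1ℤ + n - k) - n + 1ℤ) * b₁
           + ((+ 2 + n - k) * (+ 2 + n - k) + n) * b₂)
    expand = solve-∀

  -- Symmetry and unimodality of the rows

  Symmetric : ℕ → (ℕ → ℤ) → Set
  Symmetric n x = ∀ i j → suc (i ℕ.+ j) ≡ n → x i ≡ x j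

  VanishesFrom : ℕ → (ℕ → ℤ) → Set
  VanishesFrom n x = ∀ i → n ℕ.≤ i → x i ≡ 0ℤ

  module _ {n : ℕ} {x : ℕ → ℤ} (symm : Symmetric n x) (vanish : VanishesFrom n x) where

    -- The default 0 of `shiftℤ` in front of the row mirrors the vanishing behind its end, so the
    -- reflection extends across both ends.
    shiftℤ-symmetric : ∀ i j → i ℕ.+ j ≡ n → shiftℤ x i ≡ x j
    shiftℤ-symmetric zero    j eq = sym (vanish j (ℕ.≤-reflexive (sym eq)))
    shiftℤ-symmetric (suc i) j eq = symm i j eq

    shiftℤ²-symmetric : ∀ i j → i ℕ.+ j ≡ suc n → shiftℤ (shiftℤ x) i ≡ x j
    shiftℤ²-symmetric zero    j eq = sym (vanish j (ℕ.≤-trans (ℕ.n≤1+n n) (ℕ.≤-reflexive (sym eq))))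
    shiftℤ²-symmetric (suc i) j eq = shiftℤ-symmetric i j (ℕ.suc-injective eq)

    shiftℤ-shiftℤ-symmetric : ∀ i j → i ℕ.+ j ≡ suc n → shiftℤ x i ≡ shiftℤ x j
    shiftℤ-shiftℤ-symmetric i zero eq with trans (sym (ℕ.+-identityʳ i)) eq
    ... | refl = vanish n ℕ.≤-refl
    shiftℤ-shiftℤ-symmetric i (suc j) eq = shiftℤ-symmetric i j (ℕ.suc-injective (trans (sym (ℕ.+-suc i j)) eq))

  Iℤ-vanishes : ∀ n → VanishesFrom (suc n) (Iℤ (suc n))
  Iℤ-vanishes n i n<i = cong +_ (I-vanishes n i n<i)

  -- Replacing k by n+1-k in the recurrence for row n+2 exchanges the coefficients of `a` and `a₁`
  -- and those of `b` and `b₂`, and fixes that of `b₁`. Two rows are carried along because the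
  -- recurrence has order two.
  Iℤ-symmetric : ∀ n → Symmetric (suc n) (Iℤ (suc n))
  Iℤ-symmetric n = proj₁ (both n)
    where
    swapped : ∀ i j a a₁ b b₁ b₂ → recurrenceRHS (i + j - 1ℤ) i a a₁ b b₁ b₂ ≡ recurrenceRHS (i + j - 1ℤ) j a₁ a b₂ b₁ b
    swapped = expanded
      where
      expanded : ∀ k j a a₁ b b₁ b₂ →
          (1ℤ + k) * a + (+ 2 + (k + j - 1ℤ) - k) * a₁
        + (((1ℤ + k) * (1ℤ + k) + (k + j - 1ℤ)) * b
           + (+ 2 * k * (1ℤ + (k + j - 1ℤ) - k) - (k + j - 1ℤ) + 1ℤ) * b₁
           + ((+ 2 + (k + j - 1ℤ) - k) * (+ 2 + (k + j - 1ℤ) - k) + (k + j - 1ℤ)) * b₂)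
        ≡ (1ℤ + j) * a₁ + (+ 2 + (k + j - 1ℤ) - j) * a
        + (((1ℤ + j) * (1ℤ + j) + (k + j - 1ℤ)) * b₂
           + (+ 2 * j * (1ℤ + (k + j - 1ℤ) - j) - (k + j - 1ℤ) + 1ℤ) * b₁
           + ((+ 2 + (k + j - 1ℤ) - j) * (+ 2 + (k + j - 1ℤ) - j) + (k + j - 1ℤ)) * b)
      expanded = solve-∀
    both : ∀ n → Symmetric (1 ℕ.+ n) (Iℤ (1 ℕ.+ n)) × Symmetric (2 ℕ.+ n) (Iℤ (2 ℕ.+ n))
    both zero = (λ { zero zero _ → refl ; zero (suc j) () ; (suc i) j () })
              , λ { zero (suc zero) _ → refl ; (suc zero) zero _ → refl
                  ; zero zero () ; zero (suc (suc j)) () ; (suc zero) (suc j) () ; (suc (suc i)) j () }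
    both (suc n) with both n
    ... | symm₁ , symm₂ = symm₂ , λ i j eq → ℤ.*-cancelˡ-≡ (+ (3 ℕ.+ n)) _ _ (begin
      + (3 ℕ.+ n) * Iℤ (3 ℕ.+ n) i
        ≡⟨ Iℤ-recurrence (suc n) i ⟩
      recurrenceRHS (+ suc n) (+ i) (a i) (shiftℤ a i) (b i) (shiftℤ b i) (shiftℤ (shiftℤ b) i)
        ≡⟨ cong (λ t → recurrenceRHS t (+ i) (a i) (shiftℤ a i) (b i) (shiftℤ b i) (shiftℤ (shiftℤ b) i)) (index i j eq) ⟩
      recurrenceRHS (+ i + + j - 1ℤ) (+ i) (a i) (shiftℤ a i) (b i) (shiftℤ b i) (shiftℤ (shiftℤ b) i)
        ≡⟨ swapped (+ i) (+ j) (a i) (shiftℤ a i) (b i) (shiftℤ b i) (shiftℤ (shiftℤ b) i) ⟩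
      recurrenceRHS (+ i + + j - 1ℤ) (+ j) (shiftℤ a i) (a i) (shiftℤ (shiftℤ b) i) (shiftℤ b i) (b i)
        ≡⟨ cong (λ t → recurrenceRHS t (+ j) (shiftℤ a i) (a i) (shiftℤ (shiftℤ b) i) (shiftℤ b i) (b i)) (index i j eq) ⟨
      recurrenceRHS (+ suc n) (+ j) (shiftℤ a i) (a i) (shiftℤ (shiftℤ b) i) (shiftℤ b i) (b i)
        ≡⟨ cong₂ (λ s t → recurrenceRHS (+ suc n) (+ j) s t (shiftℤ (shiftℤ b) i) (shiftℤ b i) (b i))
             (shiftℤ-symmetric symm₂ (Iℤ-vanishes (suc n)) i j (ℕ.suc-injective eq))
             (sym (shiftℤ-symmetric symm₂ (Iℤ-vanishes (suc n)) j i (flip i j eq))) ⟩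
      recurrenceRHS (+ suc n) (+ j) (a j) (shiftℤ a j) (shiftℤ (shiftℤ b) i) (shiftℤ b i) (b i)
        ≡⟨ cong₂ (λ s t → recurrenceRHS (+ suc n) (+ j) (a j) (shiftℤ a j) s (shiftℤ b i) t)
             (shiftℤ²-symmetric symm₁ (Iℤ-vanishes n) i j (ℕ.suc-injective eq))
             (sym (shiftℤ²-symmetric symm₁ (Iℤ-vanishes n) j i (flip i j eq))) ⟩
      recurrenceRHS (+ suc n) (+ j) (a j) (shiftℤ a j) (b j) (shiftℤ b i) (shiftℤ (shiftℤ b) j)
        ≡⟨ cong (λ t → recurrenceRHS (+ suc n) (+ j) (a j) (shiftℤ a j) (b j) t (shiftℤ (shiftℤ b) j))
             (shiftℤ-shiftℤ-symmetric symm₁ (Iℤ-vanishes n) i j (ℕ.suc-injective eq)) ⟩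
      recurrenceRHS (+ suc n) (+ j) (a j) (shiftℤ a j) (b j) (shiftℤ b j) (shiftℤ (shiftℤ b) j)
        ≡⟨ Iℤ-recurrence (suc n) j ⟨
      + (3 ℕ.+ n) * Iℤ (3 ℕ.+ n) j ∎)
      where
      a = Iℤ (2 ℕ.+ n)
      b = Iℤ (1 ℕ.+ n)
      flip : ∀ i j → suc (i ℕ.+ j) ≡ 3 ℕ.+ n → j ℕ.+ i ≡ 2 ℕ.+ n
      flip i j eq = trans (ℕ.+-comm j i) (ℕ.suc-injective eq)
      index : ∀ i j → suc (i ℕ.+ j) ≡ 3 ℕ.+ n → + suc n ≡ + i + + j - 1ℤ
      index i j eq = trans (peel (+ n)) (cong (λ t → + t - 1ℤ) (sym (ℕ.suc-injective eq)))
        where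
        peel : ∀ m → 1ℤ + m ≡ + 2 + m - 1ℤ
        peel = solve-∀

  -- Nonnegative differences up to the middle

  0≤*0≤ : ∀ {i j} → 0ℤ ≤ i → 0ℤ ≤ j → 0ℤ ≤ i * j
  0≤*0≤ {+ m} {+ n} _ _ = subst (0ℤ ≤_) (ℤ.pos-* m n) (+≤+ z≤n)

  0≤pos : ∀ {n} → 0ℤ ≤ + n
  0≤pos = +≤+ z≤n

  -- The bound includes 2k = n, where the entries k-1 and k are mirror images.
  IncreasingToMiddle : ℕ → Set
  IncreasingToMiddle n = ∀ k → k ℕ.+ k ℕ.≤ n → 0ℤ ≤ ∇ (Iℤ n) k

  -- The coefficients of the differences at k+1, k, k-1 of row n = 2k+1+c in the recurrence for row n+2.
  combination : (K C d₀ d₁ d₂ : ℤ) → ℤ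
  combination K C d₀ d₁ d₂ =
      ((+ 2 + K) * (+ 2 + K) + (1ℤ + K + K + C)) * d₀
    + (+ 2 * K * K + + 4 * K + + 5 + + 2 * K * C + C) * d₁
    + ((+ 3 + K + C) * (+ 3 + K + C) + (1ℤ + K + K + C)) * d₂

  -- For every k the coefficients of the recurrence add up to n+3 on row n+1 and to (n+2)(n+3) on
  -- row n, so subtracting consecutive instances leaves differences only. Writing n = 2k+1+c says
  -- that k+1 lies strictly before the middle of row n+2, and turns the coefficients into
  -- polynomials in k and c without negative terms.
  ∇-recurrence : ∀ k c → let n = suc (k ℕ.+ k) ℕ.+ c ; a = Iℤ (1 ℕ.+ n) ; b = Iℤ n ; K = + k ; C = + c in
    + (2 ℕ.+ n) * ∇ (Iℤ (2 ℕ.+ n)) (suc k) ≡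
      (+ 2 + K) * ∇ a (suc k) + (+ 3 + K + C) * ∇ a k
      + combination K C (∇ b (suc k)) (∇ b k) (shiftℤ (∇ b) k)
  ∇-recurrence k c = begin
    + (2 ℕ.+ n) * (Iℤ (2 ℕ.+ n) (suc k) - Iℤ (2 ℕ.+ n) k)
      ≡⟨ distrib (+ (2 ℕ.+ n)) (Iℤ (2 ℕ.+ n) (suc k)) (Iℤ (2 ℕ.+ n) k) ⟩
    + (2 ℕ.+ n) * Iℤ (2 ℕ.+ n) (suc k) - + (2 ℕ.+ n) * Iℤ (2 ℕ.+ n) k
      ≡⟨ cong₂ _-_ (Iℤ-recurrence n (suc k)) (Iℤ-recurrence n k) ⟩
    recurrenceRHS (+ n) (+ suc k) (a (suc k)) (a k) (b (suc k)) (b k) (shiftℤ b k)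
      - recurrenceRHS (+ n) (+ k) (a k) (shiftℤ a k) (b k) (shiftℤ b k) (shiftℤ (shiftℤ b) k)
      ≡⟨ expand (+ k) (+ c) (a (suc k)) (a k) (shiftℤ a k) (b (suc k)) (b k) (shiftℤ b k) (shiftℤ (shiftℤ b) k) ⟩
    form (shiftℤ b k - shiftℤ (shiftℤ b) k)
      ≡⟨ cong form (shiftℤ-∇ b k) ⟨
    form (shiftℤ (∇ b) k) ∎
    where
    n = suc (k ℕ.+ k) ℕ.+ c
    a = Iℤ (1 ℕ.+ n)
    b = Iℤ n
    K = + k
    C = + c
    form : ℤ → ℤ
    form d = (+ 2 + K) * ∇ a (suc k) + (+ 3 + K + C) * ∇ a k
      + combination K C (∇ b (suc k)) (∇ b k) d
    distrib : ∀ m x y → m * (x - y) ≡ m * x - m * y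
    distrib = solve-∀
    expand : ∀ K C a₀ a₁ a₂ b₀ b₁ b₂ b₃ →
      ((1ℤ + (1ℤ + K)) * a₀ + (+ 2 + (1ℤ + K + K + C) - (1ℤ + K)) * a₁
        + (((1ℤ + (1ℤ + K)) * (1ℤ + (1ℤ + K)) + (1ℤ + K + K + C)) * b₀
           + (+ 2 * (1ℤ + K) * (1ℤ + (1ℤ + K + K + C) - (1ℤ + K)) - (1ℤ + K + K + C) + 1ℤ) * b₁
           + ((+ 2 + (1ℤ + K + K + C) - (1ℤ + K)) * (+ 2 + (1ℤ + K + K + C) - (1ℤ + K)) + (1ℤ + K + K + C)) * b₂))
      - ((1ℤ + K) * a₁ + (+ 2 + (1ℤ + K + K + C) - K) * a₂
        + (((1ℤ + K) * (1ℤ + K) + (1ℤ + K + K + C)) * b₁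
           + (+ 2 * K * (1ℤ + (1ℤ + K + K + C) - K) - (1ℤ + K + K + C) + 1ℤ) * b₂
           + ((+ 2 + (1ℤ + K + K + C) - K) * (+ 2 + (1ℤ + K + K + C) - K) + (1ℤ + K + K + C)) * b₃))
      ≡ (+ 2 + K) * (a₀ - a₁) + (+ 3 + K + C) * (a₁ - a₂)
      + (((+ 2 + K) * (+ 2 + K) + (1ℤ + K + K + C)) * (b₀ - b₁)
         + (+ 2 * K * K + + 4 * K + + 5 + + 2 * K * C + C) * (b₁ - b₂)
         + ((+ 3 + K + C) * (+ 3 + K + C) + (1ℤ + K + K + C)) * (b₂ - b₃))
    expand = solve-∀

  -- The ends of the range come for free: at index 0 the difference is the entry itself, and at the
  -- exact middle it is zero by symmetry.
  increasing-to-middle : ∀ n → (∀ k → suc k ℕ.+ suc k ℕ.< suc n → 0ℤ ≤ ∇ (Iℤ (suc n)) (suc k)) →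
                         IncreasingToMiddle (suc n)
  increasing-to-middle n below zero    _  = subst (0ℤ ≤_) (sym (ℤ.+-identityʳ (Iℤ (suc n) 0))) 0≤pos
  increasing-to-middle n below (suc k) le with ℕ.m≤n⇒m<n∨m≡n le
  ... | inj₁ lt = below k lt
  ... | inj₂ eq = ℤ.i≤j⇒0≤j-i (ℤ.≤-reflexive (shiftℤ-symmetric (Iℤ-symmetric n) (Iℤ-vanishes n) (suc k) (suc k) eq))

  -- The row is 1, 2, 1 with differences 1, 1, -1, and the value is -12 + 11 + 19 = 18: here the
  -- third term rescues the sum.
  I₃-combination : 0ℤ ≤ combination 1ℤ 0ℤ (∇ (Iℤ 3) 2) (∇ (Iℤ 3) 1) (shiftℤ (∇ (Iℤ 3)) 1)
  I₃-combination = +≤+ z≤n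

  combination-nonneg : ∀ k c {d₀ d₁ d₂} → 0ℤ ≤ d₀ → 0ℤ ≤ d₁ → 0ℤ ≤ d₂ → 0ℤ ≤ combination (+ k) (+ c) d₀ d₁ d₂
  combination-nonneg k c p₀ p₁ p₂ = ℤ.+-mono-≤ (ℤ.+-mono-≤
    (0≤*0≤ (ℤ.+-mono-≤ (0≤*0≤ {+ (2 ℕ.+ k)} {+ (2 ℕ.+ k)} 0≤pos 0≤pos) n≥0) p₀)
    (0≤*0≤ (ℤ.+-mono-≤ (ℤ.+-mono-≤ (ℤ.+-mono-≤ (ℤ.+-mono-≤
        (0≤*0≤ (0≤*0≤ {+ 2} {+ k} 0≤pos 0≤pos) (0≤pos {k}))
        (0≤*0≤ {+ 4} {+ k} 0≤pos 0≤pos)) (0≤pos {5}))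
        (0≤*0≤ (0≤*0≤ {+ 2} {+ k} 0≤pos 0≤pos) (0≤pos {c}))) (0≤pos {c})) p₁))
    (0≤*0≤ (ℤ.+-mono-≤ (0≤*0≤ {+ (3 ℕ.+ k ℕ.+ c)} {+ (3 ℕ.+ k ℕ.+ c)} 0≤pos 0≤pos) n≥0) p₂)
    where
    n≥0 : 0ℤ ≤ 1ℤ + + k + + k + + c
    n≥0 = 0≤pos {suc (k ℕ.+ k) ℕ.+ c}

  -- For opposite d₀ and d₁ their coefficients add up to k(k-2), which is negative only for k = 1.
  combination-opposite : ∀ k {d₁ d₂} → 0ℤ ≤ + k * (+ k - + 2) → 0ℤ ≤ d₁ → 0ℤ ≤ d₂ →
                         0ℤ ≤ combination (+ k) 0ℤ (- d₁) d₁ d₂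
  combination-opposite k {d₁} {d₂} coefficient p₁ p₂ = subst (0ℤ ≤_) (expand (+ k) d₁ d₂)
    (ℤ.+-mono-≤ (0≤*0≤ coefficient p₁)
      (0≤*0≤ (ℤ.+-mono-≤ (0≤*0≤ {+ (3 ℕ.+ k ℕ.+ 0)} {+ (3 ℕ.+ k ℕ.+ 0)} 0≤pos 0≤pos)
                         (0≤pos {suc (k ℕ.+ k) ℕ.+ 0})) p₂))
    where
    expand : ∀ K d₁ d₂ →
      K * (K - + 2) * d₁ + ((+ 3 + K + 0ℤ) * (+ 3 + K + 0ℤ) + (1ℤ + K + K + 0ℤ)) * d₂ ≡
        ((+ 2 + K) * (+ 2 + K) + (1ℤ + K + K + 0ℤ)) * (- d₁)
      + (+ 2 * K * K + + 4 * K + + 5 + + 2 * K * 0ℤ + 0ℤ) * d₁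
      + ((+ 3 + K + 0ℤ) * (+ 3 + K + 0ℤ) + (1ℤ + K + K + 0ℤ)) * d₂
    expand = solve-∀

  -- Entry k is the centre of a row of length 2k+1, and its two neighbours agree.
  ∇-opposite : ∀ k → let b = Iℤ (suc (k ℕ.+ k) ℕ.+ 0) in - ∇ b k ≡ ∇ b (suc k)
  ∇-opposite k = trans (negate (b k) (shiftℤ b k)) (cong (_- b k)
    (shiftℤ-symmetric (Iℤ-symmetric (k ℕ.+ k ℕ.+ 0)) (Iℤ-vanishes (k ℕ.+ k ℕ.+ 0)) k (suc k)
      (trans (ℕ.+-suc k k) (sym (ℕ.+-identityʳ (suc (k ℕ.+ k)))))))
    where
    b = Iℤ (suc (k ℕ.+ k) ℕ.+ 0)
    negate : ∀ x y → - (x - y) ≡ y - x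
    negate = solve-∀

  -- For c > 0 all three differences lie in the increasing half. For c = 0 the first one lies past
  -- the centre and is the opposite of the second, which leaves the coefficient k(k-2); the case k =
  -- 1 is passed on to the hypothesis about row 3.
  combination-∇-nonneg : ∀ (b : ℕ → ℤ) k c →
    (∀ k′ → k′ ℕ.+ k′ ℕ.≤ suc (k ℕ.+ k) ℕ.+ c → 0ℤ ≤ ∇ b k′) →
    (c ≡ 0 → - ∇ b k ≡ ∇ b (suc k)) →
    (k ≡ 1 → c ≡ 0 → 0ℤ ≤ combination 1ℤ 0ℤ (∇ b 2) (∇ b 1) (shiftℤ (∇ b) 1)) →
    0ℤ ≤ combination (+ k) (+ c) (∇ b (suc k)) (∇ b k) (shiftℤ (∇ b) k)
  combination-∇-nonneg b k c inc opposite exception = go k c (inc k k+k≤n) (previous k k+k≤n) inc opposite exception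
    where
    k+k≤n : k ℕ.+ k ℕ.≤ suc (k ℕ.+ k) ℕ.+ c
    k+k≤n = ℕ.≤-trans (ℕ.n≤1+n _) (ℕ.m≤m+n (suc (k ℕ.+ k)) c)
    previous : ∀ k′ → k′ ℕ.+ k′ ℕ.≤ suc (k ℕ.+ k) ℕ.+ c → 0ℤ ≤ shiftℤ (∇ b) k′
    previous zero     _  = ℤ.≤-refl
    previous (suc k′) le = inc k′ (ℕ.≤-trans (ℕ.+-mono-≤ (ℕ.n≤1+n k′) (ℕ.n≤1+n k′)) le)
    fromOpposite : ∀ k → - ∇ b k ≡ ∇ b (suc k) → 0ℤ ≤ combination (+ k) 0ℤ (- ∇ b k) (∇ b k) (shiftℤ (∇ b) k) →
                   0ℤ ≤ combination (+ k) 0ℤ (∇ b (suc k)) (∇ b k) (shiftℤ (∇ b) k)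
    fromOpposite k = subst (λ t → 0ℤ ≤ combination (+ k) 0ℤ t (∇ b k) (shiftℤ (∇ b) k))
    go : ∀ k c → 0ℤ ≤ ∇ b k → 0ℤ ≤ shiftℤ (∇ b) k →
      (∀ k′ → k′ ℕ.+ k′ ℕ.≤ suc (k ℕ.+ k) ℕ.+ c → 0ℤ ≤ ∇ b k′) →
      (c ≡ 0 → - ∇ b k ≡ ∇ b (suc k)) →
      (k ≡ 1 → c ≡ 0 → 0ℤ ≤ combination 1ℤ 0ℤ (∇ b 2) (∇ b 1) (shiftℤ (∇ b) 1)) →
      0ℤ ≤ combination (+ k) (+ c) (∇ b (suc k)) (∇ b k) (shiftℤ (∇ b) k)
    go zero          zero d₁ d₂ _ opp _ = fromOpposite 0 (opp refl) (combination-opposite 0 ℤ.≤-refl d₁ d₂)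
    go (suc zero)    zero _  _  _ _ exc = exc refl refl
    go (suc (suc m)) zero d₁ d₂ _ opp _ = fromOpposite (2 ℕ.+ m) (opp refl)
      (combination-opposite (2 ℕ.+ m) (0≤*0≤ {+ (2 ℕ.+ m)} {+ m} 0≤pos 0≤pos) d₁ d₂)
    go k (suc c) d₁ d₂ inc _ _ = combination-nonneg k (suc c) d₀ d₁ d₂
      where
      d₀ : 0ℤ ≤ ∇ b (suc k)
      d₀ = inc (suc k) (subst₂ ℕ._≤_ (cong suc (sym (ℕ.+-suc k k))) (sym (ℕ.+-suc (suc (k ℕ.+ k)) c))
        (s≤s (ℕ.m≤m+n (suc (k ℕ.+ k)) c)))

  IncreasingToMiddle-step : ∀ n → IncreasingToMiddle (suc n) → IncreasingToMiddle (2 ℕ.+ n) → IncreasingToMiddle (3 ℕ.+ n)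
  IncreasingToMiddle-step n inc₁ inc₂ = increasing-to-middle (2 ℕ.+ n) λ k lt →
    let c , eq = ℕ.m≤n⇒∃[o]m+o≡n (subst (ℕ._≤ suc n) (ℕ.+-suc k k) (ℕ.s≤s⁻¹ (ℕ.s≤s⁻¹ lt)))
    in go k c eq
    where
    go : ∀ k c → suc (k ℕ.+ k) ℕ.+ c ≡ suc n → 0ℤ ≤ ∇ (Iℤ (3 ℕ.+ n)) (suc k)
    go k c refl = ℤ.*-cancelˡ-≤-pos 0ℤ (∇ (Iℤ (3 ℕ.+ n)) (suc k)) (+ (3 ℕ.+ n)) (subst₂ _≤_
      (sym (ℤ.*-zeroʳ (+ (3 ℕ.+ n)))) (sym (∇-recurrence k c)) (ℤ.+-mono-≤ (ℤ.+-mono-≤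
        (0≤*0≤ {+ (2 ℕ.+ k)} 0≤pos (inc₂ (suc k) (s≤s (subst (ℕ._≤ suc (k ℕ.+ k ℕ.+ c)) (sym (ℕ.+-suc k k))
          (s≤s (ℕ.m≤m+n (k ℕ.+ k) c))))))
        (0≤*0≤ {+ (3 ℕ.+ k ℕ.+ c)} 0≤pos (inc₂ k (ℕ.≤-trans (ℕ.m≤m+n (k ℕ.+ k) c) (ℕ.m≤n+m (k ℕ.+ k ℕ.+ c) 2)))))
        (combination-∇-nonneg (Iℤ (suc n)) k c inc₁ (λ { refl → ∇-opposite k }) (λ { refl refl → I₃-combination }))))

  I-increasingToMiddle : ∀ n → IncreasingToMiddle (suc n)
  I-increasingToMiddle n = proj₁ (both n)
    where
    both : ∀ n → IncreasingToMiddle (suc n) × IncreasingToMiddle (2 ℕ.+ n)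
    both zero = increasing-to-middle 0 (λ { k (s≤s ()) })
              , increasing-to-middle 1 λ { zero (s≤s (s≤s ())) ; (suc k) (s≤s (s≤s ())) }
    both (suc n) with both n
    ... | inc₁ , inc₂ = inc₂ , IncreasingToMiddle-step n inc₁ inc₂

open import Data.Nat using (_≤_)
open Rows

theorem3p3 : (n : ℕ) → 1 ≤ n → Unimodal n (I n)
theorem3p3 (suc n) _ = h , ℕ.⌊n/2⌋<n n , (λ i i<h → increasing i (2i+2≤n i<h)) , decreasing
  where
  -- The central index if the length `suc n` is odd, the right one of the two central indices if it
  -- is even.
  h = ⌊ suc n /2⌋
  2i+2≤n : ∀ {i} → i ℕ.< h → suc i ℕ.+ suc i ≤ suc n
  2i+2≤n {i} i<h = begin
    suc i ℕ.+ suc i          ≤⟨ ℕ.+-mono-≤ i<h (ℕ.≤-trans i<h (ℕ.⌊n/2⌋≤⌈n/2⌉ (suc n))) ⟩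
    h ℕ.+ ⌈ suc n /2⌉        ≡⟨ ℕ.⌊n/2⌋+⌈n/2⌉≡n (suc n) ⟩
    suc n                    ∎
    where open ℕ.≤-Reasoning
  increasing : ∀ i → suc i ℕ.+ suc i ≤ suc n → I (suc n) i ≤ I (suc n) (suc i)
  increasing i le = drop‿+≤+ (ℤ.0≤i-j⇒j≤i (I-increasingToMiddle n (suc i) le))
  decreasing : ∀ i → h ≤ i → suc i ℕ.< suc n → I (suc n) (suc i) ≤ I (suc n) i
  decreasing i h≤i i<n with ℕ.m≤n⇒∃[o]m+o≡n i<n
  -- `j` is the mirror image of `suc i`, and `suc j` that of `i`: a step down behind the middle is
  -- the reflection of a step up before it.
  ... | j , eq = subst₂ _≤_
    (sym (ℤ.+-injective (Iℤ-symmetric n (suc i) j eq)))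
    (sym (ℤ.+-injective (Iℤ-symmetric n i (suc j) i+j)))
    (increasing j 2j+2≤n)
    where
    open ℕ.≤-Reasoning
    i+j : suc (i ℕ.+ suc j) ≡ suc n
    i+j = trans (cong suc (ℕ.+-suc i j)) eq
    j<i : suc j ≤ i
    j<i = ℕ.+-cancelˡ-≤ (suc i) (suc j) i (begin
      suc (i ℕ.+ suc j)  ≡⟨ i+j ⟩
      suc n              ≡⟨ ℕ.⌊n/2⌋+⌈n/2⌉≡n (suc n) ⟨
      -- `⌈ suc n /2⌉` unfolds to `⌊ 2 ℕ.+ n /2⌋`, which is at most `⌊ 3 ℕ.+ n /2⌋`, that is
      -- `suc h`.
      h ℕ.+ ⌈ suc n /2⌉  ≤⟨ ℕ.+-mono-≤ h≤i (ℕ.≤-trans (ℕ.⌊n/2⌋-mono (ℕ.n≤1+n (2 ℕ.+ n))) (s≤s h≤i)) ⟩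
      i ℕ.+ suc i        ≡⟨ ℕ.+-suc i i ⟩
      suc i ℕ.+ i        ∎)
    2j+2≤n : suc j ℕ.+ suc j ≤ suc n
    2j+2≤n = begin
      suc j ℕ.+ suc j  ≤⟨ ℕ.+-monoˡ-≤ (suc j) j<i ⟩
      i ℕ.+ suc j      ≤⟨ ℕ.n≤1+n _ ⟩
      suc (i ℕ.+ suc j) ≡⟨ i+j ⟩
      suc n            ∎
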